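{- Let $G=\{1_G,\alpha,\beta,\gamma\}$ be the Klein four group acting on a finite set $X$. Let $X_1,\dots,X_s$ be the orbits of length 4, $X_{\alpha,1},\dots,X_{\alpha,p}$ the orbits of length 2 on which $\alpha$ acts trivially, $X_{\beta,1},\dots,X_{\beta,q}$ those on which $\beta$ acts trivially, $X_{\gamma,1},\dots,X_{\gamma,r}$ those on which $\gamma$ acts trivially, and $X_{01},\dots,X_{0t}$ the orbits of length 1 (any of $s,p,q,r,t$ may be 0). Then there exists a $G$-perfect nonlinear function from $X$ to $\mathbb F_2$ if and only if one of the following holds: (i) there exists a $G$-perfect nonlinear function from $X\setminus(X_1\cup\dots\cup X_s)$ to $\mathbb F_2$; or (ii) $4\mid v_0$, where $v_0=2p+2q+2r+t$, and there are nonnegative integers $k_0,p_1,q_1,r_1$ with $p_1\le p$, $q_1\le q$, $r_1\le r$, $p_1\equiv q_1\equiv r_1 \pmod 2$, $s\ge \frac{3v_0}{4}+4k_0-2(p_1+q_1+r_1)$, and $\frac{v_0}{4}+k_0\ge\max\big\{p_1+\frac{q_1+r_1}{2},\ q_1+\frac{p_1+r_1}{2},\ r_1+\frac{p_1+q_1}{2}\big\}$.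
   Context: $\mathbb F_2$ is the additive group of order 2. For a $G$-set $W$, a function $g:W\to\mathbb F_2$ is $G$-perfect nonlinear if $2$ divides $|W|$ and for every $\delta\in G\setminus\{1_G\}$ and $\sigma\in\mathbb F_2$, $|\{w\in W:g(\delta w)-g(w)=\sigma\}|=|W|/2$. -}

module Defs where

open import Data.Nat using (ℕ; zero; suc; _+_; _*_; _≤ᵇ_)
open import Data.Nat.Divisibility using (_∣_)
open import Data.Nat.DivMod using (_/_)
open import Data.Bool using (Bool; true; false; if_then_else_; _∧_; not; _xor_)
open import Data.Bool.Properties using () renaming (_≟_ to _≟ᴮ_)
open import Data.Fin using (Fin; toℕ) renaming (zero to fz; suc to fs) renaming (_≟_ to _≟ᶠ_)
open import Data.List using (List; []; _∷_; length; deduplicate)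
open import Data.Bool.ListAction using (all)
open import Data.Product using (_×_; ∃)
open import Relation.Nullary.Decidable using (⌊_⌋)
open import Relation.Binary.PropositionalEquality using (_≡_; _≢_)

data Klein : Set where
  one α β γ : Klein

-- An action of the Klein four group on the finite set X = Fin n.
-- G = ⟨α, β | α² = β² = 1, αβ = βα⟩, γ = αβ; an action is thus given by
-- two commuting involutions of X.
record KleinAction (n : ℕ) : Set where
  field
    actα actβ : Fin n → Fin n
    αα : ∀ x → actα (actα x) ≡ x
    ββ : ∀ x → actβ (actβ x) ≡ x
    αβ : ∀ x → actα (actβ x) ≡ actβ (actα x)

  act : Klein → Fin n → Fin n
  act one x = x
  act α x = actα x
  act β x = actβ x
  act γ x = actα (actβ x)

  orbitList : Fin n → List (Fin n)
  orbitList x = act one x ∷ act α x ∷ act β x ∷ act γ x ∷ []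

  orbitLength : Fin n → ℕ
  orbitLength x = length (deduplicate _≟ᶠ_ (orbitList x))

  -- x is the chosen representative of its orbit (its least element)
  isRep : Fin n → Bool
  isRep x = all (λ y → toℕ x ≤ᵇ toℕ y) (orbitList x)

  trivialOnOrbit : Klein → Fin n → Bool
  trivialOnOrbit δ x = all (λ y → ⌊ act δ y ≟ᶠ y ⌋) (orbitList x)

  hasLength : ℕ → Fin n → Bool
  hasLength k x = ⌊ orbitLength x Data.Nat.≟ k ⌋

count : ∀ {n} → (Fin n → Bool) → ℕ
count {zero} f = 0
count {suc n} f = (if f fz then 1 else 0) + count (λ i → f (fs i))

module _ {n : ℕ} (A : KleinAction n) where
  open KleinAction A

  -- number of orbits whose points satisfy P (P should be orbit-invariant):
  -- counted via one representative per orbit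
  numOrbits : (Fin n → Bool) → ℕ
  numOrbits P = count (λ x → isRep x ∧ P x)

  s# p# q# r# t# : ℕ
  s# = numOrbits (hasLength 4)
  p# = numOrbits (λ x → hasLength 2 x ∧ trivialOnOrbit α x)
  q# = numOrbits (λ x → hasLength 2 x ∧ trivialOnOrbit β x)
  r# = numOrbits (λ x → hasLength 2 x ∧ trivialOnOrbit γ x)
  t# = numOrbits (hasLength 1)

  nonFree : Fin n → Bool
  nonFree x = not (hasLength 4 x)

  everything : Fin n → Bool
  everything _ = true

  -- g : W → F₂ is G-perfect nonlinear, for the G-set W ⊆ X given by the
  -- G-invariant subset S (only the values of g on W matter).
  -- F₂ = Bool with addition _xor_, so g(δw) - g(w) = g(δw) xor g(w).
  IsGPN : (S : Fin n → Bool) → (Fin n → Bool) → Set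
  IsGPN S g =
    (2 ∣ count S) ×
    (∀ (δ : Klein) → δ ≢ one → ∀ (σ : Bool) →
       count (λ w → S w ∧ ⌊ (g (act δ w) xor g w) ≟ᴮ σ ⌋) ≡ count S / 2)

  HasGPN : (S : Fin n → Bool) → Set
  HasGPN S = ∃ λ (g : Fin n → Bool) → IsGPN S g

-- A function g : X → F₂ is G-perfect nonlinear iff |X| is even and, for δ = α, β, γ,
-- exactly |X|/2 points w satisfy g(δw) ≠ g(w). Count these orbit by orbit. On an orbit of length 1,
-- or of length 2 fixed by δ, there are none; on any other orbit of length 2 there are 0 or 2,
-- according as g is constant on it or not. On a free orbit the count depends only on the shape of g
-- there (constant, one point odd, or split along the cosets of ⟨α⟩, ⟨β⟩ or ⟨γ⟩), contributing
-- (0,0,0), (2,2,2), (0,4,4), (4,0,4), (4,4,0) to the three counts. So perfectness of g is a system of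
-- three linear equations in the numbers of orbits of each kind, and every solution with at most s
-- non-constant free orbits, p₁ ≤ p, q₁ ≤ q, r₁ ≤ r is realised by some g. Eliminating the free-orbit
-- numbers gives condition (ii). A perfect function on X ∖ (X₁ ∪ … ∪ X_s) forces p₁ = q₁ = r₁ and
-- v₀ = 8p₁, which is the case k₀ = 0 of (ii); hence (i) implies (ii).

module Submission where

open import Defs
open import Data.Nat using (ℕ; zero; suc; _+_; _*_; _∸_; _≤_; _⊔_; _%_; z≤n; s≤s; _≤ᵇ_)
open import Data.Nat.Properties
open import Data.Nat.Divisibility using (_∣_; divides; ∣m+n∣m⇒∣n)
open import Data.Nat.DivMod using (_/_; m*n/n≡m; m*[n/m]≡n; m≡m%n+[m/n]*n; [m+kn]%n≡m%n)
open import Data.Nat.Tactic.RingSolver using (solve-∀)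
open import Data.Integer using (ℤ; +_; -_; _-_; +≤+) renaming (_+_ to _+ℤ_; _≤_ to _≤ℤ_)
import Data.Integer.Properties as ℤ
open import Data.Bool using (Bool; true; false; not; _∧_; _∨_; _xor_; if_then_else_; T)
open import Data.Bool.Properties using (xor-same; xor-comm; ∧-zeroʳ; ∨-identityʳ) renaming (_≟_ to _≟ᴮ_)
open import Data.Fin using (Fin; toℕ) renaming (zero to fz; suc to fs; _≟_ to _≟ᶠ_)
open import Data.Fin.Properties using (toℕ-injective)
open import Data.Fin.Permutation using (permutation)
open import Data.List using (List; []; _∷_; _++_; length; deduplicate; filter; replicate; drop)
open import Data.List.Properties using (length-++; length-replicate)
open import Data.Product using (_×_; _,_; ∃; proj₁; proj₂)
open import Data.Sum using (_⊎_; inj₁; inj₂; [_,_])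
open import Data.Empty using (⊥-elim)
open import Function using (_∘_; id)
open import Function.Bundles using (_⇔_; mk⇔; Equivalence)
open import Relation.Nullary using (¬_; Dec; yes; no)
open import Relation.Nullary.Decidable using (⌊_⌋; ¬?)
open import Relation.Binary.PropositionalEquality hiding ([_])
open import Relation.Binary.Definitions using (DecidableEquality)
open import Algebra.Properties.Semiring.Sum +-*-semiring
  using (sum; sum-cong-≗; ∑-distrib-+; sum-permute; *-distribˡ-sum; sum-replicate-zero)

cong₃ : ∀ {A B C D : Set} (f : A → B → C → D) {a a′ b b′ c c′} →
  a ≡ a′ → b ≡ b′ → c ≡ c′ → f a b c ≡ f a′ b′ c′
cong₃ f refl refl refl = refl

cong₄ : ∀ {A B C D E : Set} (f : A → B → C → D → E) {a a′ b b′ c c′ d d′} →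
  a ≡ a′ → b ≡ b′ → c ≡ c′ → d ≡ d′ → f a b c d ≡ f a′ b′ c′ d′
cong₄ f refl refl refl refl = refl

𝕀 : Bool → ℕ
𝕀 b = if b then 1 else 0

𝕀≤1 : ∀ b → 𝕀 b ≤ 1
𝕀≤1 true = ≤-refl
𝕀≤1 false = z≤n

𝕀-∧ : ∀ a b → 𝕀 (a ∧ b) ≡ 𝕀 a * 𝕀 b
𝕀-∧ true b = sym (+-identityʳ (𝕀 b))
𝕀-∧ false b = refl

𝕀≡0 : ∀ {b} → 𝕀 b ≡ 0 → b ≡ false
𝕀≡0 {false} _ = refl

count≡∑ : ∀ {n} (P : Fin n → Bool) → count P ≡ sum (𝕀 ∘ P)
count≡∑ {zero} P = refl
count≡∑ {suc n} P = cong (λ m → 𝕀 (P fz) + m) (count≡∑ (P ∘ fs))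

∑-mono-≤ : ∀ {n} {f g : Fin n → ℕ} → (∀ x → f x ≤ g x) → sum f ≤ sum g
∑-mono-≤ {zero} f≤g = z≤n
∑-mono-≤ {suc n} f≤g = +-mono-≤ (f≤g fz) (∑-mono-≤ (f≤g ∘ fs))

∑-zero : ∀ {n} {f : Fin n → ℕ} → (∀ x → f x ≡ 0) → sum f ≡ 0
∑-zero {n} f≡0 = trans (sum-cong-≗ f≡0) (sum-replicate-zero n)

∑-involution : ∀ {n} (σ : Fin n → Fin n) → (∀ x → σ (σ x) ≡ x) → (f : Fin n → ℕ) → sum f ≡ sum (f ∘ σ)
∑-involution σ σσ f = sum-permute f (permutation σ σ σσ σσ)

⌊≟true⌋ : ∀ b → ⌊ b ≟ᴮ true ⌋ ≡ b
⌊≟true⌋ true = refl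
⌊≟true⌋ false = refl

count-by-value : ∀ {n} (S h : Fin n → Bool) →
  count (λ w → S w ∧ ⌊ h w ≟ᴮ false ⌋) + count (λ w → S w ∧ ⌊ h w ≟ᴮ true ⌋) ≡ count S
count-by-value {zero} S h = refl
count-by-value {suc n} S h =
  trans (shuffle (𝕀 (S fz ∧ ⌊ h fz ≟ᴮ false ⌋)) (𝕀 (S fz ∧ ⌊ h fz ≟ᴮ true ⌋)) _ _)
        (cong₂ _+_ (at-zero (S fz) (h fz)) (count-by-value (S ∘ fs) (h ∘ fs)))
  where
  shuffle : ∀ a b c d → a + c + (b + d) ≡ a + b + (c + d)
  shuffle = solve-∀
  at-zero : ∀ s b → 𝕀 (s ∧ ⌊ b ≟ᴮ false ⌋) + 𝕀 (s ∧ ⌊ b ≟ᴮ true ⌋) ≡ 𝕀 s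
  at-zero true true = refl
  at-zero true false = refl
  at-zero false _ = refl


sumOn : ∀ {n} → (Fin n → Bool) → (Fin n → ℕ) → ℕ
sumOn P F = sum (λ y → 𝕀 (P y) * F y)

module _ {n : ℕ} (P : Fin n → Bool) where

  sumOn-cong : ∀ {F G : Fin n → ℕ} → (∀ y → P y ≡ true → F y ≡ G y) → sumOn P F ≡ sumOn P G
  sumOn-cong {F} {G} F≡G = sum-cong-≗ pointwise
    where
    pointwise : ∀ y → 𝕀 (P y) * F y ≡ 𝕀 (P y) * G y
    pointwise y with P y in Py
    ... | true = cong (1 *_) (F≡G y Py)
    ... | false = refl

  sumOn-zero : ∀ {F : Fin n → ℕ} → (∀ y → P y ≡ true → F y ≡ 0) → sumOn P F ≡ 0
  sumOn-zero F≡0 = trans (sumOn-cong F≡0) (∑-zero (λ y → *-zeroʳ (𝕀 (P y))))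

  sumOn-+ : ∀ (F G : Fin n → ℕ) → sumOn P (λ y → F y + G y) ≡ sumOn P F + sumOn P G
  sumOn-+ F G = trans (sum-cong-≗ (λ y → *-distribˡ-+ (𝕀 (P y)) (F y) (G y)))
    (∑-distrib-+ (λ y → 𝕀 (P y) * F y) (λ y → 𝕀 (P y) * G y))

  sumOn-*ˡ : ∀ k (F : Fin n → ℕ) → sumOn P (λ y → k * F y) ≡ k * sumOn P F
  sumOn-*ˡ k F = trans (sum-cong-≗ (λ y → x*[k*z]≡k*[x*z] (𝕀 (P y)) k (F y))) (sym (*-distribˡ-sum k (λ y → 𝕀 (P y) * F y)))
    where
    x*[k*z]≡k*[x*z] : ∀ x k z → x * (k * z) ≡ k * (x * z)
    x*[k*z]≡k*[x*z] = solve-∀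

  sumOn-mono-≤ : ∀ {F G : Fin n → ℕ} → (∀ y → F y ≤ G y) → sumOn P F ≤ sumOn P G
  sumOn-mono-≤ F≤G = ∑-mono-≤ (λ y → *-monoʳ-≤ (𝕀 (P y)) (F≤G y))

  sumOn-shift : ∀ {σ : Fin n → Fin n} → (∀ y → σ (σ y) ≡ y) → (∀ y → P (σ y) ≡ P y) →
    ∀ (ρ F : Fin n → ℕ) → sumOn P (λ y → ρ y * F (σ y)) ≡ sumOn P (λ y → ρ (σ y) * F y)
  sumOn-shift {σ} σσ Pσ ρ F = trans (sum-cong-≗ pointwise) (sym (∑-involution σ σσ _))
    where
    pointwise : ∀ y → 𝕀 (P y) * (ρ y * F (σ y)) ≡ 𝕀 (P (σ y)) * (ρ (σ (σ y)) * F (σ y))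
    pointwise y rewrite Pσ y | σσ y = refl

sumOn-true : ∀ {n} (F : Fin n → ℕ) → sumOn (λ _ → true) F ≡ sum F
sumOn-true F = sum-cong-≗ (λ y → +-identityʳ (F y))

sumOn-split : ∀ {n} {Q : Fin n → Bool} (P₁ P₂ : Fin n → Bool) →
  (∀ y → 𝕀 (Q y) ≡ 𝕀 (P₁ y) + 𝕀 (P₂ y)) → ∀ F → sumOn Q F ≡ sumOn P₁ F + sumOn P₂ F
sumOn-split {Q = Q} P₁ P₂ split F =
  trans (sum-cong-≗ pointwise) (∑-distrib-+ (λ y → 𝕀 (P₁ y) * F y) (λ y → 𝕀 (P₂ y) * F y))
  where
  pointwise : ∀ y → 𝕀 (Q y) * F y ≡ 𝕀 (P₁ y) * F y + 𝕀 (P₂ y) * F y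
  pointwise y = trans (cong (_* F y) (split y)) (*-distribʳ-+ (F y) (𝕀 (P₁ y)) (𝕀 (P₂ y)))

sumOn-split₄ : ∀ {n} {Q : Fin n → Bool} (P₁ P₂ P₃ P₄ : Fin n → Bool) →
  (∀ y → 𝕀 (Q y) ≡ 𝕀 (P₁ y) + 𝕀 (P₂ y) + 𝕀 (P₃ y) + 𝕀 (P₄ y)) → ∀ F →
  sumOn Q F ≡ sumOn P₁ F + sumOn P₂ F + sumOn P₃ F + sumOn P₄ F
sumOn-split₄ {Q = Q} P₁ P₂ P₃ P₄ split F = begin
  sumOn Q F                                                  ≡⟨ sum-cong-≗ pointwise ⟩
  sum (λ y → f₁ y + f₂ y + f₃ y + f₄ y)                      ≡⟨ ∑-distrib-+ (λ y → f₁ y + f₂ y + f₃ y) f₄ ⟩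
  sum (λ y → f₁ y + f₂ y + f₃ y) + sum f₄                    ≡⟨ cong (_+ sum f₄) (∑-distrib-+ (λ y → f₁ y + f₂ y) f₃) ⟩
  sum (λ y → f₁ y + f₂ y) + sum f₃ + sum f₄                  ≡⟨ cong (λ m → m + sum f₃ + sum f₄) (∑-distrib-+ f₁ f₂) ⟩
  sum f₁ + sum f₂ + sum f₃ + sum f₄                          ∎
  where
  open ≡-Reasoning
  f₁ f₂ f₃ f₄ : Fin _ → ℕ
  f₁ y = 𝕀 (P₁ y) * F y
  f₂ y = 𝕀 (P₂ y) * F y
  f₃ y = 𝕀 (P₃ y) * F y
  f₄ y = 𝕀 (P₄ y) * F y
  distrib : ∀ a b c d x → (a + b + c + d) * x ≡ a * x + b * x + c * x + d * x
  distrib = solve-∀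
  pointwise : ∀ y → 𝕀 (Q y) * F y ≡ f₁ y + f₂ y + f₃ y + f₄ y
  pointwise y = trans (cong (_* F y) (split y)) (distrib (𝕀 (P₁ y)) (𝕀 (P₂ y)) (𝕀 (P₃ y)) (𝕀 (P₄ y)) (F y))

occurrences : ∀ {L : Set} → (L → Bool) → List L → ℕ
occurrences f [] = 0
occurrences f (x ∷ xs) = 𝕀 (f x) + occurrences f xs

occurrences-++ : ∀ {L : Set} (f : L → Bool) (xs ys : List L) →
  occurrences f (xs ++ ys) ≡ occurrences f xs + occurrences f ys
occurrences-++ f [] ys = refl
occurrences-++ f (x ∷ xs) ys = trans (cong (λ m → 𝕀 (f x) + m) (occurrences-++ f xs ys)) (sym (+-assoc (𝕀 (f x)) _ _))

occurrences-replicate : ∀ {L : Set} (f : L → Bool) k x → occurrences f (replicate k x) ≡ k * 𝕀 (f x)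
occurrences-replicate f zero x = refl
occurrences-replicate f (suc k) x = cong (λ m → 𝕀 (f x) + m) (occurrences-replicate f k x)

-- deal d ls P hands the labels ls out, in order, to the points satisfying P; all other points get d.
deal : ∀ {n} {L : Set} → L → List L → (Fin n → Bool) → Fin n → L
deal d ls P fz with P fz | ls
... | true | ℓ ∷ _ = ℓ
... | _ | _ = d
deal d ls P (fs i) = deal d (if P fz then drop 1 ls else ls) (P ∘ fs) i

deal-outside : ∀ {n} {L : Set} (d : L) ls (P : Fin n → Bool) y → P y ≡ false → deal d ls P y ≡ d
deal-outside d ls P fz Py with P fz
deal-outside d ls P fz refl | false = refl
deal-outside d ls P (fs i) Py = deal-outside d _ (P ∘ fs) i Py

count-deal : ∀ {n} {L : Set} {d : L} (f : L → Bool) → f d ≡ false → ∀ ls (P : Fin n → Bool) →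
  length ls ≤ count P → count (f ∘ deal d ls P) ≡ occurrences f ls
count-deal {zero} f fd≡false [] P _ = refl
count-deal {suc n} {d = d} f fd≡false ls P ls≤ with P fz
count-deal {suc n} f fd≡false [] P _ | true
  rewrite fd≡false = count-deal f fd≡false [] (P ∘ fs) z≤n
count-deal {suc n} f fd≡false (ℓ ∷ ls) P (s≤s ls≤) | true =
  cong (λ m → 𝕀 (f ℓ) + m) (count-deal f fd≡false ls (P ∘ fs) ls≤)
count-deal {suc n} f fd≡false [] P ls≤ | false
  rewrite fd≡false = count-deal f fd≡false [] (P ∘ fs) ls≤
count-deal {suc n} f fd≡false (ℓ ∷ ls) P ls≤ | false
  rewrite fd≡false = count-deal f fd≡false (ℓ ∷ ls) (P ∘ fs) ls≤

module _ {A : Set} (_≟_ : DecidableEquality A) where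

  private
    dropping : A → List A → List A
    dropping a = filter (λ y → ¬? (a ≟ y))

    dropping-keep : ∀ {a x} xs → a ≢ x → dropping a (x ∷ xs) ≡ x ∷ dropping a xs
    dropping-keep {a} {x} xs a≢x with a ≟ x
    ... | yes a≡x = ⊥-elim (a≢x a≡x)
    ... | no _ = refl

    dropping-drop : ∀ {a} xs → dropping a (a ∷ xs) ≡ dropping a xs
    dropping-drop {a} xs with a ≟ a
    ... | yes _ = refl
    ... | no a≢a = ⊥-elim (a≢a refl)

  distinct : List A → ℕ
  distinct xs = length (deduplicate _≟_ xs)

  distinct-abcd : ∀ {a b c d} → a ≢ b → a ≢ c → a ≢ d → b ≢ c → b ≢ d → c ≢ d →
    distinct (a ∷ b ∷ c ∷ d ∷ []) ≡ 4
  distinct-abcd {a} {b} {c} {d} a≢b a≢c a≢d b≢c b≢d c≢d = cong (suc ∘ length) (begin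
    dropping a (b ∷ dropping b (c ∷ dropping c (d ∷ [])))
      ≡⟨ cong (λ l → dropping a (b ∷ dropping b (c ∷ l))) (dropping-keep [] c≢d) ⟩
    dropping a (b ∷ dropping b (c ∷ d ∷ []))
      ≡⟨ cong (λ l → dropping a (b ∷ l)) (trans (dropping-keep _ b≢c) (cong (c ∷_) (dropping-keep [] b≢d))) ⟩
    dropping a (b ∷ c ∷ d ∷ [])
      ≡⟨ trans (dropping-keep _ a≢b) (cong (b ∷_) (trans (dropping-keep _ a≢c) (cong (c ∷_) (dropping-keep [] a≢d)))) ⟩
    b ∷ c ∷ d ∷ [] ∎)
    where open ≡-Reasoning

  distinct-aabb : ∀ {a b} → a ≢ b → distinct (a ∷ a ∷ b ∷ b ∷ []) ≡ 2
  distinct-aabb {a} {b} a≢b = cong (suc ∘ length) (begin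
    dropping a (a ∷ dropping a (b ∷ dropping b (b ∷ [])))
      ≡⟨ cong (λ l → dropping a (a ∷ dropping a (b ∷ l))) (dropping-drop []) ⟩
    dropping a (a ∷ dropping a (b ∷ []))
      ≡⟨ cong (λ l → dropping a (a ∷ l)) (dropping-keep [] a≢b) ⟩
    dropping a (a ∷ b ∷ [])
      ≡⟨ trans (dropping-drop _) (dropping-keep [] a≢b) ⟩
    b ∷ [] ∎)
    where open ≡-Reasoning

  distinct-abab : ∀ {a b} → a ≢ b → distinct (a ∷ b ∷ a ∷ b ∷ []) ≡ 2
  distinct-abab {a} {b} a≢b = cong (suc ∘ length) (begin
    dropping a (b ∷ dropping b (a ∷ dropping a (b ∷ [])))
      ≡⟨ cong (λ l → dropping a (b ∷ dropping b (a ∷ l))) (dropping-keep [] a≢b) ⟩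
    dropping a (b ∷ dropping b (a ∷ b ∷ []))
      ≡⟨ cong (λ l → dropping a (b ∷ l)) (trans (dropping-keep _ (a≢b ∘ sym)) (cong (a ∷_) (dropping-drop []))) ⟩
    dropping a (b ∷ a ∷ [])
      ≡⟨ trans (dropping-keep _ a≢b) (cong (b ∷_) (dropping-drop [])) ⟩
    b ∷ [] ∎)
    where open ≡-Reasoning

  distinct-abba : ∀ {a b} → a ≢ b → distinct (a ∷ b ∷ b ∷ a ∷ []) ≡ 2
  distinct-abba {a} {b} a≢b = cong (suc ∘ length) (begin
    dropping a (b ∷ dropping b (b ∷ dropping b (a ∷ [])))
      ≡⟨ cong (λ l → dropping a (b ∷ dropping b (b ∷ l))) (dropping-keep [] (a≢b ∘ sym)) ⟩
    dropping a (b ∷ dropping b (b ∷ a ∷ []))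
      ≡⟨ cong (λ l → dropping a (b ∷ l)) (trans (dropping-drop _) (dropping-keep [] (a≢b ∘ sym))) ⟩
    dropping a (b ∷ a ∷ [])
      ≡⟨ trans (dropping-keep _ a≢b) (cong (b ∷_) (dropping-drop [])) ⟩
    b ∷ [] ∎)
    where open ≡-Reasoning

  distinct-aaaa : ∀ a → distinct (a ∷ a ∷ a ∷ a ∷ []) ≡ 1
  distinct-aaaa a = cong (suc ∘ length) (begin
    dropping a (a ∷ dropping a (a ∷ dropping a (a ∷ [])))
      ≡⟨ cong (λ l → dropping a (a ∷ dropping a (a ∷ l))) (dropping-drop []) ⟩
    dropping a (a ∷ dropping a (a ∷ []))
      ≡⟨ cong (λ l → dropping a (a ∷ l)) (dropping-drop []) ⟩
    dropping a (a ∷ [])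
      ≡⟨ dropping-drop [] ⟩
    [] ∎)
    where open ≡-Reasoning

∧≡true : ∀ {a b} → a ∧ b ≡ true → a ≡ true × b ≡ true
∧≡true {true} e = refl , e

LowerBound : ℕ → ℕ → ℕ → ℕ → ℕ → Set
LowerBound m a b c d = m ≤ a × m ≤ b × m ≤ c × m ≤ d

lowerBound? : ℕ → ℕ → ℕ → ℕ → ℕ → Bool
lowerBound? m a b c d = (m ≤ᵇ a) ∧ ((m ≤ᵇ b) ∧ ((m ≤ᵇ c) ∧ ((m ≤ᵇ d) ∧ true)))

≤ᵇ≡true⇔≤ : ∀ {m n} → (m ≤ᵇ n) ≡ true ⇔ m ≤ n
≤ᵇ≡true⇔≤ {m} {n} = mk⇔ (λ e → ≤ᵇ⇒≤ m n (subst T (sym e) _)) complete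
  where
  complete : m ≤ n → (m ≤ᵇ n) ≡ true
  complete m≤n with m ≤ᵇ n | ≤⇒≤ᵇ m≤n
  ... | true | _ = refl

lowerBound?⇔ : ∀ {m a b c d} → lowerBound? m a b c d ≡ true ⇔ LowerBound m a b c d
lowerBound?⇔ = mk⇔ sound complete
  where
  open Equivalence
  sound : ∀ {m a b c d} → lowerBound? m a b c d ≡ true → LowerBound m a b c d
  sound e with (ea , e) ← ∧≡true e with (eb , e) ← ∧≡true e with (ec , e) ← ∧≡true e with (ed , _) ← ∧≡true e =
    to ≤ᵇ≡true⇔≤ ea , to ≤ᵇ≡true⇔≤ eb , to ≤ᵇ≡true⇔≤ ec , to ≤ᵇ≡true⇔≤ ed
  complete : ∀ {m a b c d} → LowerBound m a b c d → lowerBound? m a b c d ≡ true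
  complete (p , q , r , s)
    rewrite from ≤ᵇ≡true⇔≤ p | from ≤ᵇ≡true⇔≤ q | from ≤ᵇ≡true⇔≤ r | from ≤ᵇ≡true⇔≤ s = refl

LowerBound-2143 : ∀ {m a b c d} → LowerBound m a b c d → LowerBound m b a d c
LowerBound-2143 (p , q , r , s) = q , p , s , r

LowerBound-3412 : ∀ {m a b c d} → LowerBound m a b c d → LowerBound m c d a b
LowerBound-3412 (p , q , r , s) = r , s , p , q

LowerBound-4321 : ∀ {m a b c d} → LowerBound m a b c d → LowerBound m d c b a
LowerBound-4321 (p , q , r , s) = s , r , q , p

LowerBound-aabb : ∀ {m b} → LowerBound m m m b b ⇔ m ≤ b
LowerBound-aabb = mk⇔ (proj₁ ∘ proj₂ ∘ proj₂) (λ h → ≤-refl , ≤-refl , h , h)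

LowerBound-abab : ∀ {m b} → LowerBound m m b m b ⇔ m ≤ b
LowerBound-abab = mk⇔ (proj₁ ∘ proj₂) (λ h → ≤-refl , h , ≤-refl , h)

LowerBound-abba : ∀ {m b} → LowerBound m m b b m ⇔ m ≤ b
LowerBound-abba = mk⇔ (proj₁ ∘ proj₂) (λ h → ≤-refl , h , h , ≤-refl)

some-lowerBound : ∀ a b c d →
  LowerBound a a b c d ⊎ LowerBound b a b c d ⊎ LowerBound c a b c d ⊎ LowerBound d a b c d
some-lowerBound a b c d with ≤-total a b | ≤-total c d
some-lowerBound a b c d | inj₁ a≤b | inj₁ c≤d with ≤-total a c
... | inj₁ a≤c = inj₁ (≤-refl , a≤b , a≤c , ≤-trans a≤c c≤d)
... | inj₂ c≤a = inj₂ (inj₂ (inj₁ (c≤a , ≤-trans c≤a a≤b , ≤-refl , c≤d)))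
some-lowerBound a b c d | inj₁ a≤b | inj₂ d≤c with ≤-total a d
... | inj₁ a≤d = inj₁ (≤-refl , a≤b , ≤-trans a≤d d≤c , a≤d)
... | inj₂ d≤a = inj₂ (inj₂ (inj₂ (d≤a , ≤-trans d≤a a≤b , d≤c , ≤-refl)))
some-lowerBound a b c d | inj₂ b≤a | inj₁ c≤d with ≤-total b c
... | inj₁ b≤c = inj₂ (inj₁ (b≤a , ≤-refl , b≤c , ≤-trans b≤c c≤d))
... | inj₂ c≤b = inj₂ (inj₂ (inj₁ (≤-trans c≤b b≤a , c≤b , ≤-refl , c≤d)))
some-lowerBound a b c d | inj₂ b≤a | inj₂ d≤c with ≤-total b d
... | inj₁ b≤d = inj₂ (inj₁ (b≤a , ≤-refl , ≤-trans b≤d d≤c , b≤d))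
... | inj₂ d≤b = inj₂ (inj₂ (inj₂ (≤-trans d≤b b≤a , d≤b , d≤c , ≤-refl)))

not-below-least : ∀ {m : Bool} {x y : ℕ} → (m ≡ true → y ≤ x) → x ≤ y → x ≢ y → m ≡ false
not-below-least {false} _ _ _ = refl
not-below-least {true} y≤x x≤y x≢y = ⊥-elim (x≢y (≤-antisym x≤y (y≤x refl)))

module _ {a b c d : ℕ} {ma mb mc md : Bool}
         (fa : ma ≡ true ⇔ LowerBound a a b c d) (fb : mb ≡ true ⇔ LowerBound b a b c d)
         (fc : mc ≡ true ⇔ LowerBound c a b c d) (fd : md ≡ true ⇔ LowerBound d a b c d) where
  open Equivalence

  exactly-one-least-of-four : a ≢ b → a ≢ c → a ≢ d → b ≢ c → b ≢ d → c ≢ d →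
    𝕀 ma + 𝕀 mb + 𝕀 mc + 𝕀 md ≡ 1
  exactly-one-least-of-four a≢b a≢c a≢d b≢c b≢d c≢d with some-lowerBound a b c d
  ... | inj₁ lb@(_ , a≤b , a≤c , a≤d)
    rewrite from fa lb
          | not-below-least (proj₁ ∘ to fb) a≤b a≢b
          | not-below-least (proj₁ ∘ to fc) a≤c a≢c
          | not-below-least (proj₁ ∘ to fd) a≤d a≢d = refl
  ... | inj₂ (inj₁ lb@(b≤a , _ , b≤c , b≤d))
    rewrite from fb lb
          | not-below-least (proj₁ ∘ proj₂ ∘ to fa) b≤a (a≢b ∘ sym)
          | not-below-least (proj₁ ∘ proj₂ ∘ to fc) b≤c b≢c
          | not-below-least (proj₁ ∘ proj₂ ∘ to fd) b≤d b≢d = refl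
  ... | inj₂ (inj₂ (inj₁ lb@(c≤a , c≤b , _ , c≤d)))
    rewrite from fc lb
          | not-below-least (proj₁ ∘ proj₂ ∘ proj₂ ∘ to fa) c≤a (a≢c ∘ sym)
          | not-below-least (proj₁ ∘ proj₂ ∘ proj₂ ∘ to fb) c≤b (b≢c ∘ sym)
          | not-below-least (proj₁ ∘ proj₂ ∘ proj₂ ∘ to fd) c≤d c≢d = refl
  ... | inj₂ (inj₂ (inj₂ lb@(d≤a , d≤b , d≤c , _)))
    rewrite from fd lb
          | not-below-least (proj₂ ∘ proj₂ ∘ proj₂ ∘ to fa) d≤a (a≢d ∘ sym)
          | not-below-least (proj₂ ∘ proj₂ ∘ proj₂ ∘ to fb) d≤b (b≢d ∘ sym)
          | not-below-least (proj₂ ∘ proj₂ ∘ proj₂ ∘ to fc) d≤c (c≢d ∘ sym) = refl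

exactly-one-least-of-two : ∀ {a b : ℕ} {ma mb : Bool} → ma ≡ true ⇔ a ≤ b → mb ≡ true ⇔ b ≤ a →
  a ≢ b → 𝕀 ma + 𝕀 mb ≡ 1
exactly-one-least-of-two {a} {b} fa fb a≢b with ≤-total a b
... | inj₁ a≤b rewrite Equivalence.from fa a≤b | not-below-least (Equivalence.to fb) a≤b a≢b = refl
... | inj₂ b≤a rewrite Equivalence.from fb b≤a | not-below-least (Equivalence.to fa) b≤a (a≢b ∘ sym) = refl

-- The shape of g on a free orbit {y, αy, βy, γy}, up to complementing g: constant, odd (one point
-- differs from the other three), or splitδ (constant on both cosets of ⟨δ⟩ but not globally).
-- freeOrbitType reads the shape off the differences dδ = g(δy) xor g(y).
data FreeOrbitType : Set where
  constant odd splitα splitβ splitγ : FreeOrbitType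

freeOrbitType : (dα dβ dγ : Bool) → FreeOrbitType
freeOrbitType false false false = constant
freeOrbitType false true  true  = splitα
freeOrbitType true  false true  = splitβ
freeOrbitType true  true  false = splitγ
freeOrbitType true  false false = odd
freeOrbitType false true  false = odd
freeOrbitType false false true  = odd
freeOrbitType true  true  true  = odd

isOdd isSplitα isSplitβ isSplitγ nonConstant : FreeOrbitType → Bool
isOdd odd = true
isOdd _ = false
isSplitα splitα = true
isSplitα _ = false
isSplitβ splitβ = true
isSplitβ _ = false
isSplitγ splitγ = true
isSplitγ _ = false
nonConstant constant = false
nonConstant _ = true

at-most-one-type : ∀ t → 𝕀 (isOdd t) + 𝕀 (isSplitα t) + 𝕀 (isSplitβ t) + 𝕀 (isSplitγ t) ≤ 1
at-most-one-type constant = z≤n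
at-most-one-type odd = ≤-refl
at-most-one-type splitα = ≤-refl
at-most-one-type splitβ = ≤-refl
at-most-one-type splitγ = ≤-refl

-- The points w of a free orbit with g(αw) ≠ g(w) are y, αy (if dα) and βy, γy (if dβ ≠ dγ),
-- so the left-hand side is half their number; similarly for β and γ.
weightα : ∀ dα dβ dγ → let t = freeOrbitType dα dβ dγ in
  𝕀 dα + 𝕀 (dβ xor dγ) ≡ 𝕀 (isOdd t) + 2 * 𝕀 (isSplitβ t) + 2 * 𝕀 (isSplitγ t)
weightα false false false = refl
weightα false true  true  = refl
weightα true  false true  = refl
weightα true  true  false = refl
weightα true  false false = refl
weightα false true  false = refl
weightα false false true  = refl
weightα true  true  true  = refl

weightβ : ∀ dα dβ dγ → let t = freeOrbitType dα dβ dγ in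
  𝕀 dβ + 𝕀 (dα xor dγ) ≡ 𝕀 (isOdd t) + 2 * 𝕀 (isSplitα t) + 2 * 𝕀 (isSplitγ t)
weightβ false false false = refl
weightβ false true  true  = refl
weightβ true  false true  = refl
weightβ true  true  false = refl
weightβ true  false false = refl
weightβ false true  false = refl
weightβ false false true  = refl
weightβ true  true  true  = refl

weightγ : ∀ dα dβ dγ → let t = freeOrbitType dα dβ dγ in
  𝕀 dγ + 𝕀 (dα xor dβ) ≡ 𝕀 (isOdd t) + 2 * 𝕀 (isSplitα t) + 2 * 𝕀 (isSplitβ t)
weightγ false false false = refl
weightγ false true  true  = refl
weightγ true  false true  = refl
weightγ true  true  false = refl
weightγ true  false false = refl
weightγ false true  false = refl
weightγ false false true  = refl
weightγ true  true  true  = refl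

freeOrbitType-of-pattern : ∀ t → let u = nonConstant t in
  freeOrbitType (isSplitα t xor u) (isSplitβ t xor u) (isSplitγ t xor u) ≡ t
freeOrbitType-of-pattern constant = refl
freeOrbitType-of-pattern odd = refl
freeOrbitType-of-pattern splitα = refl
freeOrbitType-of-pattern splitβ = refl
freeOrbitType-of-pattern splitγ = refl

xor-cancelʳ : ∀ a b u → (a xor u) xor (b xor u) ≡ a xor b
xor-cancelʳ true  true  true  = refl
xor-cancelʳ true  true  false = refl
xor-cancelʳ true  false true  = refl
xor-cancelʳ true  false false = refl
xor-cancelʳ false true  true  = refl
xor-cancelʳ false true  false = refl
xor-cancelʳ false false true  = refl
xor-cancelʳ false false false = refl

-- For g : X → F₂: a, cα, cβ, cγ count the free orbits of shape odd, splitα, splitβ, splitγ, and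
-- p₁, q₁, r₁ the orbits of length 2 on which α, β, γ act trivially and g is not constant.
-- By the weight lemmas, 2·Δδ is the number of w with g(δw) ≠ g(w).
record Profile : Set where
  constructor profile
  field a cα cβ cγ p₁ q₁ r₁ : ℕ

  Δα Δβ Δγ : ℕ
  Δα = a + 2 * cβ + 2 * cγ + q₁ + r₁
  Δβ = a + 2 * cα + 2 * cγ + p₁ + r₁
  Δγ = a + 2 * cα + 2 * cβ + p₁ + q₁

Admissible : (s p q r : ℕ) → Profile → Set
Admissible s p q r π = a + cα + cβ + cγ ≤ s × p₁ ≤ p × q₁ ≤ q × r₁ ≤ r
  where open Profile π

profile-≡ : ∀ {a a′ cα cα′ cβ cβ′ cγ cγ′ p₁ p₁′ q₁ q₁′ r₁ r₁′} →
  a ≡ a′ → cα ≡ cα′ → cβ ≡ cβ′ → cγ ≡ cγ′ → p₁ ≡ p₁′ → q₁ ≡ q₁′ → r₁ ≡ r₁′ →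
  profile a cα cβ cγ p₁ q₁ r₁ ≡ profile a′ cα′ cβ′ cγ′ p₁′ q₁′ r₁′
profile-≡ refl refl refl refl refl refl refl = refl

Balanced : ℕ → Profile → Set
Balanced N π = 4 * Δα ≡ N × 4 * Δβ ≡ N × 4 * Δγ ≡ N
  where open Profile π

Condition : (s p q r v₀ : ℕ) → Set
Condition s p q r v₀ =
  (4 ∣ v₀) ×
  ∃ λ (k₀ : ℕ) → ∃ λ (p₁ : ℕ) → ∃ λ (q₁ : ℕ) → ∃ λ (r₁ : ℕ) →
    (p₁ ≤ p) × (q₁ ≤ q) × (r₁ ≤ r) ×
    (p₁ % 2 ≡ q₁ % 2) × (q₁ % 2 ≡ r₁ % 2) ×
    ((+ (3 * (v₀ / 4)) +ℤ + (4 * k₀)) - + (2 * (p₁ + q₁ + r₁)) ≤ℤ + s) ×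
    (((2 * p₁ + (q₁ + r₁)) ⊔ (2 * q₁ + (p₁ + r₁))) ⊔ (2 * r₁ + (p₁ + q₁)) ≤ 2 * (v₀ / 4 + k₀))

ℤ-inequality⇔ : ∀ x y z w → ((+ x +ℤ + y) - + z ≤ℤ + w) ⇔ (x + y ≤ w + z)
ℤ-inequality⇔ x y z w = mk⇔ from-ℤ to-ℤ
  where
  cancel : ∀ (i j : ℤ) → i - j +ℤ j ≡ i
  cancel i j = trans (ℤ.+-assoc i (- j) j) (trans (cong (i +ℤ_) (ℤ.+-inverseˡ j)) (ℤ.+-identityʳ i))
  cancel′ : ∀ (i j : ℤ) → i +ℤ j - j ≡ i
  cancel′ i j = trans (ℤ.+-assoc i j (- j)) (trans (cong (i +ℤ_) (ℤ.+-inverseʳ j)) (ℤ.+-identityʳ i))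
  from-ℤ : (+ x +ℤ + y) - + z ≤ℤ + w → x + y ≤ w + z
  from-ℤ h = ℤ.drop‿+≤+ (subst₂ _≤ℤ_ (trans (cancel (+ x +ℤ + y) (+ z)) (sym (ℤ.pos-+ x y))) (sym (ℤ.pos-+ w z))
                                      (ℤ.+-monoˡ-≤ (+ z) h))
  to-ℤ : x + y ≤ w + z → (+ x +ℤ + y) - + z ≤ℤ + w
  to-ℤ h = subst (_ ≤ℤ_) (cancel′ (+ w) (+ z))
             (ℤ.+-monoˡ-≤ (- + z) (subst₂ _≤ℤ_ (ℤ.pos-+ x y) (ℤ.pos-+ w z) (+≤+ h)))

%2-shift : ∀ x c y c′ → x + 2 * c ≡ y + 2 * c′ → x % 2 ≡ y % 2
%2-shift x c y c′ e = begin
  x % 2              ≡⟨ [m+kn]%n≡m%n x c 2 ⟨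
  (x + c * 2) % 2    ≡⟨ cong (_% 2) (trans (cong (λ u → x + u) (*-comm c 2)) (trans e (cong (λ u → y + u) (*-comm 2 c′)))) ⟩
  (y + c′ * 2) % 2   ≡⟨ [m+kn]%n≡m%n y c′ 2 ⟩
  y % 2              ∎
  where open ≡-Reasoning

same-parity⇒even-sum : ∀ x y → x % 2 ≡ y % 2 → ∃ λ j → x + y ≡ 2 * j
same-parity⇒even-sum x y e = x % 2 + x / 2 + y / 2 , (begin
  x + y                                        ≡⟨ cong₂ _+_ (m≡m%n+[m/n]*n x 2) (m≡m%n+[m/n]*n y 2) ⟩
  x % 2 + x / 2 * 2 + (y % 2 + y / 2 * 2)      ≡⟨ cong (λ z → x % 2 + x / 2 * 2 + (z + y / 2 * 2)) (sym e) ⟩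
  x % 2 + x / 2 * 2 + (x % 2 + y / 2 * 2)      ≡⟨ regroup (x % 2) (x / 2) (y / 2) ⟩
  2 * (x % 2 + x / 2 + y / 2)                  ∎)
  where
  open ≡-Reasoning
  regroup : ∀ a b c → a + b * 2 + (a + c * 2) ≡ 2 * (a + b + c)
  regroup = solve-∀

Bounds : (s m k₀ p₁ q₁ r₁ : ℕ) → Set
Bounds s m k₀ p₁ q₁ r₁ =
  (p₁ % 2 ≡ q₁ % 2) × (q₁ % 2 ≡ r₁ % 2) × (3 * m + 4 * k₀ ≤ s + 2 * (p₁ + q₁ + r₁)) ×
  (((2 * p₁ + (q₁ + r₁)) ⊔ (2 * q₁ + (p₁ + r₁))) ⊔ (2 * r₁ + (p₁ + q₁)) ≤ 2 * (m + k₀))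

module _ {s m a cα cβ cγ p₁ q₁ r₁ : ℕ} where
  open Profile (profile a cα cβ cγ p₁ q₁ r₁) using (Δα; Δβ; Δγ)

  -- Write s = a + cα + cβ + cγ + k₀; adding the balance equations two or three at a time
  -- gives the bounds, subtracting them two at a time gives the parities.
  balanced⇒bounds : a + cα + cβ + cγ ≤ s → Δα ≡ s + m → Δβ ≡ s + m → Δγ ≡ s + m →
    ∃ λ k₀ → Bounds s m k₀ p₁ q₁ r₁
  balanced⇒bounds fits eα eβ eγ with m≤n⇒∃[o]m+o≡n fits
  ... | k₀ , refl = k₀ , parityα , parityβ , bound , ⊔-lub (⊔-lub Lα Lβ) Lγ
    where
    P : ℕ
    P = p₁ + q₁ + r₁
    parityα : p₁ % 2 ≡ q₁ % 2
    parityα = %2-shift p₁ cα q₁ cβ (+-cancelʳ-≡ (a + 2 * cγ + r₁) _ _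
      (trans (shapeβ a cα cβ cγ p₁ q₁ r₁) (trans (trans eβ (sym eα)) (sym (shapeα a cα cβ cγ p₁ q₁ r₁)))))
      where
      shapeβ : ∀ a cα cβ cγ p₁ q₁ r₁ → p₁ + 2 * cα + (a + 2 * cγ + r₁) ≡ a + 2 * cα + 2 * cγ + p₁ + r₁
      shapeβ = solve-∀
      shapeα : ∀ a cα cβ cγ p₁ q₁ r₁ → q₁ + 2 * cβ + (a + 2 * cγ + r₁) ≡ a + 2 * cβ + 2 * cγ + q₁ + r₁
      shapeα = solve-∀
    parityβ : q₁ % 2 ≡ r₁ % 2
    parityβ = %2-shift q₁ cβ r₁ cγ (+-cancelʳ-≡ (a + 2 * cα + p₁) _ _
      (trans (shapeγ a cα cβ cγ p₁ q₁ r₁) (trans (trans eγ (sym eβ)) (sym (shapeβ a cα cβ cγ p₁ q₁ r₁)))))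
      where
      shapeγ : ∀ a cα cβ cγ p₁ q₁ r₁ → q₁ + 2 * cβ + (a + 2 * cα + p₁) ≡ a + 2 * cα + 2 * cβ + p₁ + q₁
      shapeγ = solve-∀
      shapeβ : ∀ a cα cβ cγ p₁ q₁ r₁ → r₁ + 2 * cγ + (a + 2 * cα + p₁) ≡ a + 2 * cα + 2 * cγ + p₁ + r₁
      shapeβ = solve-∀
    C : ℕ
    C = cα + cβ + cγ
    C+2P≡3k₀+3m : C + 2 * P ≡ 3 * k₀ + 3 * m
    C+2P≡3k₀+3m = +-cancelʳ-≡ (3 * a + 3 * C) _ _ (begin
      C + 2 * P + (3 * a + 3 * C)                      ≡⟨ sum-of-Δ a cα cβ cγ p₁ q₁ r₁ ⟩
      Δα + Δβ + Δγ                                     ≡⟨ cong₃ (λ x y z → x + y + z) eα eβ eγ ⟩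
      (a + cα + cβ + cγ + k₀ + m) + (a + cα + cβ + cγ + k₀ + m) + (a + cα + cβ + cγ + k₀ + m) ≡⟨ three-s a cα cβ cγ k₀ m ⟩
      3 * k₀ + 3 * m + (3 * a + 3 * C)                 ∎)
      where
      open ≡-Reasoning
      sum-of-Δ : ∀ a cα cβ cγ p₁ q₁ r₁ → cα + cβ + cγ + 2 * (p₁ + q₁ + r₁) + (3 * a + 3 * (cα + cβ + cγ)) ≡
        (a + 2 * cβ + 2 * cγ + q₁ + r₁) + (a + 2 * cα + 2 * cγ + p₁ + r₁) + (a + 2 * cα + 2 * cβ + p₁ + q₁)
      sum-of-Δ = solve-∀
      three-s : ∀ a cα cβ cγ k₀ m → (a + cα + cβ + cγ + k₀ + m) + (a + cα + cβ + cγ + k₀ + m) + (a + cα + cβ + cγ + k₀ + m) ≡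
        3 * k₀ + 3 * m + (3 * a + 3 * (cα + cβ + cγ))
      three-s = solve-∀
    bound : 3 * m + 4 * k₀ ≤ a + cα + cβ + cγ + k₀ + 2 * P
    bound = subst (3 * m + 4 * k₀ ≤_) (begin
      a + (3 * m + 4 * k₀)        ≡⟨ regroup a k₀ m ⟩
      a + k₀ + (3 * k₀ + 3 * m)   ≡⟨ cong (λ x → a + k₀ + x) C+2P≡3k₀+3m ⟨
      a + k₀ + (C + 2 * P)        ≡⟨ regroup′ a cα cβ cγ k₀ P ⟩
      a + cα + cβ + cγ + k₀ + 2 * P ∎) (m≤n+m _ a)
      where
      open ≡-Reasoning
      regroup : ∀ a k₀ m → a + (3 * m + 4 * k₀) ≡ a + k₀ + (3 * k₀ + 3 * m)
      regroup = solve-∀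
      regroup′ : ∀ a cα cβ cγ k₀ P → a + k₀ + (cα + cβ + cγ + 2 * P) ≡ a + cα + cβ + cγ + k₀ + 2 * P
      regroup′ = solve-∀
    from-pair : ∀ c L {Δ₁ Δ₂} → Δ₁ ≡ a + cα + cβ + cγ + k₀ + m → Δ₂ ≡ a + cα + cβ + cγ + k₀ + m →
      2 * a + 2 * C + (2 * c + L) ≡ Δ₁ + Δ₂ → L ≤ 2 * (m + k₀)
    from-pair c L e₁ e₂ shape = subst (L ≤_) eq (m≤n+m L (2 * c))
      where
      double : ∀ a cα cβ cγ k₀ m → a + cα + cβ + cγ + k₀ + m + (a + cα + cβ + cγ + k₀ + m) ≡
        2 * a + 2 * (cα + cβ + cγ) + 2 * (m + k₀)
      double = solve-∀
      eq : 2 * c + L ≡ 2 * (m + k₀)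
      eq = +-cancelˡ-≡ (2 * a + 2 * C) _ _ (trans shape (trans (cong₂ _+_ e₁ e₂) (double a cα cβ cγ k₀ m)))
    Lα : 2 * p₁ + (q₁ + r₁) ≤ 2 * (m + k₀)
    Lα = from-pair cα _ eβ eγ (shape a cα cβ cγ p₁ q₁ r₁)
      where
      shape : ∀ a cα cβ cγ p₁ q₁ r₁ → 2 * a + 2 * (cα + cβ + cγ) + (2 * cα + (2 * p₁ + (q₁ + r₁))) ≡
        (a + 2 * cα + 2 * cγ + p₁ + r₁) + (a + 2 * cα + 2 * cβ + p₁ + q₁)
      shape = solve-∀
    Lβ : 2 * q₁ + (p₁ + r₁) ≤ 2 * (m + k₀)
    Lβ = from-pair cβ _ eα eγ (shape a cα cβ cγ p₁ q₁ r₁)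
      where
      shape : ∀ a cα cβ cγ p₁ q₁ r₁ → 2 * a + 2 * (cα + cβ + cγ) + (2 * cβ + (2 * q₁ + (p₁ + r₁))) ≡
        (a + 2 * cβ + 2 * cγ + q₁ + r₁) + (a + 2 * cα + 2 * cβ + p₁ + q₁)
      shape = solve-∀
    Lγ : 2 * r₁ + (p₁ + q₁) ≤ 2 * (m + k₀)
    Lγ = from-pair cγ _ eα eβ (shape a cα cβ cγ p₁ q₁ r₁)
      where
      shape : ∀ a cα cβ cγ p₁ q₁ r₁ → 2 * a + 2 * (cα + cβ + cγ) + (2 * cγ + (2 * r₁ + (p₁ + q₁))) ≡
        (a + 2 * cβ + 2 * cγ + q₁ + r₁) + (a + 2 * cα + 2 * cγ + p₁ + r₁)
      shape = solve-∀

halve : ∀ M p j → 2 * p + 2 * j ≤ 2 * M → ∃ λ c → 2 * c + (2 * p + 2 * j) ≡ 2 * M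
halve M p j h = M ∸ (p + j) , (begin
  2 * (M ∸ (p + j)) + (2 * p + 2 * j) ≡⟨ cong (λ x → 2 * (M ∸ (p + j)) + x) (*-distribˡ-+ 2 p j) ⟨
  2 * (M ∸ (p + j)) + 2 * (p + j)     ≡⟨ *-distribˡ-+ 2 (M ∸ (p + j)) (p + j) ⟨
  2 * (M ∸ (p + j) + (p + j))         ≡⟨ cong (2 *_) (m∸n+n≡m p+j≤M) ⟩
  2 * M                               ∎)
  where
  open ≡-Reasoning
  p+j≤M : p + j ≤ M
  p+j≤M = *-cancelˡ-≤ 2 (subst (_≤ 2 * M) (sym (*-distribˡ-+ 2 p j)) h)

module _ {s m k₀ p₁ q₁ r₁ : ℕ} where

  -- Each cδ is half the slack in the corresponding max-bound, and a is the slack in the lower bound on s.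
  bounds⇒balanced : Bounds s m k₀ p₁ q₁ r₁ →
    ∃ λ a → ∃ λ cα → ∃ λ cβ → ∃ λ cγ → let open Profile (profile a cα cβ cγ p₁ q₁ r₁) using (Δα; Δβ; Δγ) in
      (a + cα + cβ + cγ ≤ s) × (Δα ≡ s + m) × (Δβ ≡ s + m) × (Δγ ≡ s + m)
  bounds⇒balanced (parityα , parityβ , bound , max)
    with same-parity⇒even-sum q₁ r₁ parityβ | same-parity⇒even-sum p₁ r₁ (trans parityα parityβ)
       | same-parity⇒even-sum p₁ q₁ parityα
  ... | jα , q₁+r₁≡2jα | jβ , p₁+r₁≡2jβ | jγ , p₁+q₁≡2jγ
    with halve (m + k₀) p₁ jα (subst (λ x → 2 * p₁ + x ≤ 2 * (m + k₀)) q₁+r₁≡2jα (m⊔n≤o⇒m≤o _ (2 * q₁ + (p₁ + r₁)) (m⊔n≤o⇒m≤o _ (2 * r₁ + (p₁ + q₁)) max)))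
       | halve (m + k₀) q₁ jβ (subst (λ x → 2 * q₁ + x ≤ 2 * (m + k₀)) p₁+r₁≡2jβ (m⊔n≤o⇒n≤o (2 * p₁ + (q₁ + r₁)) _ (m⊔n≤o⇒m≤o _ (2 * r₁ + (p₁ + q₁)) max)))
       | halve (m + k₀) r₁ jγ (subst (λ x → 2 * r₁ + x ≤ 2 * (m + k₀)) p₁+q₁≡2jγ (m⊔n≤o⇒n≤o ((2 * p₁ + (q₁ + r₁)) ⊔ (2 * q₁ + (p₁ + r₁))) _ max))
       | m≤n⇒∃[o]m+o≡n bound
  ... | cα , Fα′ | cβ , Fβ′ | cγ , Fγ′ | a , Fa = a , cα , cβ , cγ , fits , Eα , Eβ , Eγ
    where
    open ≡-Reasoning
    M P : ℕ
    M = m + k₀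
    P = p₁ + q₁ + r₁
    Fα : 2 * cα + (2 * p₁ + (q₁ + r₁)) ≡ 2 * M
    Fα = trans (cong (λ x → 2 * cα + (2 * p₁ + x)) q₁+r₁≡2jα) Fα′
    Fβ : 2 * cβ + (2 * q₁ + (p₁ + r₁)) ≡ 2 * M
    Fβ = trans (cong (λ x → 2 * cβ + (2 * q₁ + x)) p₁+r₁≡2jβ) Fβ′
    Fγ : 2 * cγ + (2 * r₁ + (p₁ + q₁)) ≡ 2 * M
    Fγ = trans (cong (λ x → 2 * cγ + (2 * r₁ + x)) p₁+q₁≡2jγ) Fγ′
    C+2P≡3M : cα + cβ + cγ + 2 * P ≡ 3 * M
    C+2P≡3M = *-cancelˡ-≡ _ _ 2 (begin
      2 * (cα + cβ + cγ + 2 * P)                     ≡⟨ split cα cβ cγ p₁ q₁ r₁ ⟩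
      (2 * cα + (2 * p₁ + (q₁ + r₁))) + (2 * cβ + (2 * q₁ + (p₁ + r₁))) + (2 * cγ + (2 * r₁ + (p₁ + q₁)))
        ≡⟨ cong₃ (λ x y z → x + y + z) Fα Fβ Fγ ⟩
      2 * M + 2 * M + 2 * M                          ≡⟨ triple M ⟩
      2 * (3 * M)                                    ∎)
      where
      split : ∀ cα cβ cγ p₁ q₁ r₁ → 2 * (cα + cβ + cγ + 2 * (p₁ + q₁ + r₁)) ≡
        (2 * cα + (2 * p₁ + (q₁ + r₁))) + (2 * cβ + (2 * q₁ + (p₁ + r₁))) + (2 * cγ + (2 * r₁ + (p₁ + q₁)))
      split = solve-∀
      triple : ∀ M → 2 * M + 2 * M + 2 * M ≡ 2 * (3 * M)
      triple = solve-∀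
    fits : a + cα + cβ + cγ ≤ s
    fits = subst (a + cα + cβ + cγ ≤_) (+-cancelʳ-≡ (3 * m + 3 * k₀ + 2 * P) _ _ (begin
      a + cα + cβ + cγ + k₀ + (3 * m + 3 * k₀ + 2 * P)   ≡⟨ regroup a cα cβ cγ k₀ m P ⟩
      (3 * m + 4 * k₀ + a) + (cα + cβ + cγ + 2 * P)     ≡⟨ cong₂ _+_ Fa C+2P≡3M ⟩
      s + 2 * P + 3 * M                                 ≡⟨ regroup′ s P m k₀ ⟩
      s + (3 * m + 3 * k₀ + 2 * P)                      ∎)) (m≤m+n _ k₀)
      where
      regroup : ∀ a cα cβ cγ k₀ m P → a + cα + cβ + cγ + k₀ + (3 * m + 3 * k₀ + 2 * P) ≡ (3 * m + 4 * k₀ + a) + (cα + cβ + cγ + 2 * P)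
      regroup = solve-∀
      regroup′ : ∀ s P m k₀ → s + 2 * P + 3 * (m + k₀) ≡ s + (3 * m + 3 * k₀ + 2 * P)
      regroup′ = solve-∀
    balance : ∀ Δ {X Y} → Δ + 2 * P ≡ a + (X + Y) → X ≡ 2 * M → Y ≡ 2 * M → Δ ≡ s + m
    balance Δ {X} {Y} shape eX eY = +-cancelʳ-≡ (3 * m + 4 * k₀ + 2 * P) _ _ (begin
      Δ + (3 * m + 4 * k₀ + 2 * P)        ≡⟨ regroup Δ m k₀ P ⟩
      3 * m + 4 * k₀ + (Δ + 2 * P)        ≡⟨ cong (λ z → 3 * m + 4 * k₀ + z) shape ⟩
      3 * m + 4 * k₀ + (a + (X + Y))      ≡⟨ cong (λ z → 3 * m + 4 * k₀ + (a + z)) (cong₂ _+_ eX eY) ⟩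
      3 * m + 4 * k₀ + (a + (2 * M + 2 * M)) ≡⟨ +-assoc (3 * m + 4 * k₀) a _ ⟨
      3 * m + 4 * k₀ + a + (2 * M + 2 * M)   ≡⟨ cong (_+ (2 * M + 2 * M)) Fa ⟩
      s + 2 * P + (2 * M + 2 * M)         ≡⟨ regroup′ s m k₀ P ⟩
      s + m + (3 * m + 4 * k₀ + 2 * P)    ∎)
      where
      regroup : ∀ Δ m k₀ P → Δ + (3 * m + 4 * k₀ + 2 * P) ≡ 3 * m + 4 * k₀ + (Δ + 2 * P)
      regroup = solve-∀
      regroup′ : ∀ s m k₀ P → s + 2 * P + (2 * (m + k₀) + 2 * (m + k₀)) ≡ s + m + (3 * m + 4 * k₀ + 2 * P)
      regroup′ = solve-∀
    Eα : a + 2 * cβ + 2 * cγ + q₁ + r₁ ≡ s + m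
    Eα = balance _ (shape a cβ cγ p₁ q₁ r₁) Fβ Fγ
      where
      shape : ∀ a cβ cγ p₁ q₁ r₁ → a + 2 * cβ + 2 * cγ + q₁ + r₁ + 2 * (p₁ + q₁ + r₁) ≡
        a + ((2 * cβ + (2 * q₁ + (p₁ + r₁))) + (2 * cγ + (2 * r₁ + (p₁ + q₁))))
      shape = solve-∀
    Eβ : a + 2 * cα + 2 * cγ + p₁ + r₁ ≡ s + m
    Eβ = balance _ (shape a cα cγ p₁ q₁ r₁) Fα Fγ
      where
      shape : ∀ a cα cγ p₁ q₁ r₁ → a + 2 * cα + 2 * cγ + p₁ + r₁ + 2 * (p₁ + q₁ + r₁) ≡
        a + ((2 * cα + (2 * p₁ + (q₁ + r₁))) + (2 * cγ + (2 * r₁ + (p₁ + q₁))))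
      shape = solve-∀
    Eγ : a + 2 * cα + 2 * cβ + p₁ + q₁ ≡ s + m
    Eγ = balance _ (shape a cα cβ p₁ q₁ r₁) Fα Fβ
      where
      shape : ∀ a cα cβ p₁ q₁ r₁ → a + 2 * cα + 2 * cβ + p₁ + q₁ + 2 * (p₁ + q₁ + r₁) ≡
        a + ((2 * cα + (2 * p₁ + (q₁ + r₁))) + (2 * cβ + (2 * q₁ + (p₁ + r₁))))
      shape = solve-∀

balanced⇔condition : ∀ s p q r v₀ →
  (∃ λ π → Admissible s p q r π × Balanced (4 * s + v₀) π) ⇔ Condition s p q r v₀
balanced⇔condition s p q r v₀ = mk⇔ forward backward
  where
  open Equivalence
  quarter : 4 ∣ v₀ → 4 * (v₀ / 4) ≡ v₀
  quarter = m*[n/m]≡n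
  divisible : ∀ Δ → 4 * Δ ≡ 4 * s + v₀ → 4 ∣ v₀
  divisible Δ e = ∣m+n∣m⇒∣n (divides Δ (trans (sym e) (*-comm 4 Δ))) (divides s (*-comm 4 s))
  unquadruple : ∀ Δ → 4 ∣ v₀ → 4 * Δ ≡ 4 * s + v₀ → Δ ≡ s + v₀ / 4
  unquadruple Δ 4∣v₀ e =
    *-cancelˡ-≡ _ _ 4 (trans e (trans (cong (λ x → 4 * s + x) (sym (quarter 4∣v₀))) (sym (*-distribˡ-+ 4 s (v₀ / 4)))))
  forward : (∃ λ π → Admissible s p q r π × Balanced (4 * s + v₀) π) → Condition s p q r v₀
  forward (π@(profile a cα cβ cγ p₁ q₁ r₁) , (fits , p₁≤p , q₁≤q , r₁≤r) , (bα , bβ , bγ)) =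
    let (k₀ , parityα , parityβ , bound , max) =
          balanced⇒bounds {s} {v₀ / 4} {a} {cα} {cβ} {cγ} {p₁} {q₁} {r₁} fits
            (unquadruple Δα 4∣v₀ bα) (unquadruple Δβ 4∣v₀ bβ) (unquadruple Δγ 4∣v₀ bγ)
    in 4∣v₀ , k₀ , p₁ , q₁ , r₁ , p₁≤p , q₁≤q , r₁≤r , parityα , parityβ ,
       from (ℤ-inequality⇔ (3 * (v₀ / 4)) (4 * k₀) (2 * (p₁ + q₁ + r₁)) s) bound , max
    where
    open Profile π using (Δα; Δβ; Δγ)
    4∣v₀ : 4 ∣ v₀
    4∣v₀ = divisible Δα bα
  backward : Condition s p q r v₀ → ∃ λ π → Admissible s p q r π × Balanced (4 * s + v₀) π
  backward (4∣v₀ , k₀ , p₁ , q₁ , r₁ , p₁≤p , q₁≤q , r₁≤r , parityα , parityβ , inequality , max)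
    with bounds⇒balanced {s} {v₀ / 4} {k₀} {p₁} {q₁} {r₁}
           (parityα , parityβ , to (ℤ-inequality⇔ (3 * (v₀ / 4)) (4 * k₀) (2 * (p₁ + q₁ + r₁)) s) inequality , max)
  ... | a , cα , cβ , cγ , fits , eα , eβ , eγ =
    profile a cα cβ cγ p₁ q₁ r₁ , (fits , p₁≤p , q₁≤q , r₁≤r) , (quadruple eα , quadruple eβ , quadruple eγ)
    where
    quadruple : ∀ {Δ} → Δ ≡ s + v₀ / 4 → 4 * Δ ≡ 4 * s + v₀
    quadruple {Δ} e = trans (cong (4 *_) e) (trans (*-distribˡ-+ 4 s (v₀ / 4)) (cong (λ x → 4 * s + x) (quarter 4∣v₀)))

four-times-injective : ∀ {u w v} → 2 * (2 * u) ≡ v → 2 * (2 * w) ≡ v → u ≡ w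
four-times-injective {u} {w} e e′ = *-cancelˡ-≡ u w 2 (*-cancelˡ-≡ (2 * u) (2 * w) 2 (trans e (sym e′)))

equal-pairs⇒condition : ∀ s p q r v₀ {p₁ q₁ r₁} → p₁ ≤ p → q₁ ≤ q → r₁ ≤ r →
  2 * (2 * (q₁ + r₁)) ≡ v₀ → 2 * (2 * (p₁ + r₁)) ≡ v₀ → 2 * (2 * (p₁ + q₁)) ≡ v₀ → Condition s p q r v₀
equal-pairs⇒condition s p q r v₀ {x} {q₁} {r₁} x≤p q₁≤q r₁≤r eα eβ eγ
  with refl ← +-cancelʳ-≡ r₁ q₁ x (four-times-injective eα eβ)
  with refl ← +-cancelˡ-≡ x r₁ q₁ (four-times-injective eβ eγ) =
  divides (2 * x) v₀≡2x*4 , 0 , x , x , x , x≤p , q₁≤q , r₁≤r , refl , refl ,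
  from (ℤ-inequality⇔ (3 * (v₀ / 4)) (4 * 0) (2 * (x + x + x)) s) (subst (_≤ s + 2 * (x + x + x)) (sym 3m≡6x) (m≤n+m _ s)) ,
  ⊔-lub (⊔-lub four-x four-x) four-x
  where
  open Equivalence
  v₀≡2x*4 : v₀ ≡ 2 * x * 4
  v₀≡2x*4 = trans (sym eγ) (shape x)
    where
    shape : ∀ x → 2 * (2 * (x + x)) ≡ 2 * x * 4
    shape = solve-∀
  m≡2x : v₀ / 4 ≡ 2 * x
  m≡2x = trans (cong (_/ 4) v₀≡2x*4) (m*n/n≡m (2 * x) 4)
  3m≡6x : 3 * (v₀ / 4) + 4 * 0 ≡ 2 * (x + x + x)
  3m≡6x = trans (cong (λ m → 3 * m + 4 * 0) m≡2x) (shape x)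
    where
    shape : ∀ x → 3 * (2 * x) + 4 * 0 ≡ 2 * (x + x + x)
    shape = solve-∀
  four-x : 2 * x + (x + x) ≤ 2 * (v₀ / 4 + 0)
  four-x = ≤-reflexive (trans (shape x) (cong (λ m → 2 * (m + 0)) (sym m≡2x)))
    where
    shape : ∀ x → 2 * x + (x + x) ≡ 2 * (2 * x + 0)
    shape = solve-∀

⌊⌋-yes : ∀ {P : Set} (p : Dec P) → P → ⌊ p ⌋ ≡ true
⌊⌋-yes (yes _) _ = refl
⌊⌋-yes (no ¬p) p = ⊥-elim (¬p p)

⌊⌋-no : ∀ {P : Set} (p : Dec P) → ¬ P → ⌊ p ⌋ ≡ false
⌊⌋-no (yes p) ¬p = ⊥-elim (¬p p)
⌊⌋-no (no _) _ = refl

⌊⌋-⇔ : ∀ {P Q : Set} → P ⇔ Q → (p : Dec P) (q : Dec Q) → ⌊ p ⌋ ≡ ⌊ q ⌋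
⌊⌋-⇔ P⇔Q p (yes q) = ⌊⌋-yes p (Equivalence.from P⇔Q q)
⌊⌋-⇔ P⇔Q p (no ¬q) = ⌊⌋-no p (¬q ∘ Equivalence.to P⇔Q)

data Subgroup : Set where
  𝟙 ⟨α⟩ ⟨β⟩ ⟨γ⟩ 𝔾 : Subgroup

classify : (fixesα fixesβ fixesγ : Bool) → Subgroup
classify true  true  _     = 𝔾
classify true  false _     = ⟨α⟩
classify false true  _     = ⟨β⟩
classify false false true  = ⟨γ⟩
classify false false false = 𝟙

index : Subgroup → ℕ
index 𝟙 = 4
index ⟨α⟩ = 2
index ⟨β⟩ = 2
index ⟨γ⟩ = 2
index 𝔾 = 1

_∋_ : Subgroup → Klein → Bool
_ ∋ one = true
𝔾 ∋ _ = true
⟨α⟩ ∋ α = true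
⟨β⟩ ∋ β = true
⟨γ⟩ ∋ γ = true
_ ∋ _ = false

_==_ : Subgroup → Subgroup → Bool
𝟙 == 𝟙 = true
⟨α⟩ == ⟨α⟩ = true
⟨β⟩ == ⟨β⟩ = true
⟨γ⟩ == ⟨γ⟩ = true
𝔾 == 𝔾 = true
_ == _ = false

==-sound : ∀ {H K} → (H == K) ≡ true → H ≡ K
==-sound {𝟙} {𝟙} _ = refl
==-sound {⟨α⟩} {⟨α⟩} _ = refl
==-sound {⟨β⟩} {⟨β⟩} _ = refl
==-sound {⟨γ⟩} {⟨γ⟩} _ = refl
==-sound {𝔾} {𝔾} _ = refl

module _ {n : ℕ} (A : KleinAction n) where
  open KleinAction A

  infixr 9 α·_ β·_ γ·_
  α·_ β·_ γ·_ : Fin n → Fin n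
  α·_ = act α
  β·_ = act β
  γ·_ = act γ

  γγ : ∀ y → γ· γ· y ≡ y
  γγ y = trans (αβ _) (trans (cong actβ (αα (actβ y))) (ββ y))

  βα≡γ : ∀ y → β· α· y ≡ γ· y
  βα≡γ y = sym (αβ y)
  γα≡β : ∀ y → γ· α· y ≡ β· y
  γα≡β y = trans (cong actα (sym (αβ y))) (αα (actβ y))
  γβ≡α : ∀ y → γ· β· y ≡ α· y
  γβ≡α y = cong actα (ββ y)
  αγ≡β : ∀ y → α· γ· y ≡ β· y
  αγ≡β y = αα (actβ y)
  βγ≡α : ∀ y → β· γ· y ≡ α· y
  βγ≡α y = trans (sym (αβ (actβ y))) (cong actα (ββ y))

  γ≡β-if-α-fixes : ∀ {y} → α· y ≡ y → γ· y ≡ β· y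
  γ≡β-if-α-fixes {y} a = trans (αβ y) (cong actβ a)
  γ≡α-if-β-fixes : ∀ {y} → β· y ≡ y → γ· y ≡ α· y
  γ≡α-if-β-fixes b = cong actα b
  β≡α-if-γ-fixes : ∀ {y} → γ· y ≡ y → β· y ≡ α· y
  β≡α-if-γ-fixes {y} c = trans (sym (αγ≡β y)) (cong actα c)

  act-α-comm : ∀ δ y → act δ (α· y) ≡ α· act δ y
  act-α-comm one y = refl
  act-α-comm α y = refl
  act-α-comm β y = sym (αβ y)
  act-α-comm γ y = cong actα (sym (αβ y))

  act-β-comm : ∀ δ y → act δ (β· y) ≡ β· act δ y
  act-β-comm one y = refl
  act-β-comm α y = αβ y
  act-β-comm β y = refl
  act-β-comm γ y = αβ (actβ y)

  α-injective : ∀ {x y} → α· x ≡ α· y → x ≡ y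
  α-injective {x} {y} e = trans (sym (αα x)) (trans (cong actα e) (αα y))

  Fixed : Klein → Fin n → Set
  Fixed δ y = act δ y ≡ y

  -- As G is abelian, the points of an orbit all have the same stabilizer.
  Fixed-along : ∀ {σ : Fin n → Fin n} → (∀ x → σ (σ x) ≡ x) → (∀ δ x → act δ (σ x) ≡ σ (act δ x)) →
    ∀ δ y → Fixed δ (σ y) ⇔ Fixed δ y
  Fixed-along {σ} σσ comm δ y = mk⇔
    (λ e → trans (sym (σσ _)) (trans (cong σ (trans (sym (comm δ y)) e)) (σσ y)))
    (λ e → trans (comm δ y) (cong σ e))

  fixes : Klein → Fin n → Bool
  fixes δ y = ⌊ act δ y ≟ᶠ y ⌋

  stab : Fin n → Subgroup
  stab y = classify (fixes α y) (fixes β y) (fixes γ y)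

  stab-along : ∀ {σ : Fin n → Fin n} → (∀ x → σ (σ x) ≡ x) → (∀ δ x → act δ (σ x) ≡ σ (act δ x)) →
    ∀ y → stab (σ y) ≡ stab y
  stab-along σσ comm y
    rewrite ⌊⌋-⇔ (Fixed-along σσ comm α y) (act α _ ≟ᶠ _) (act α y ≟ᶠ y)
          | ⌊⌋-⇔ (Fixed-along σσ comm β y) (act β _ ≟ᶠ _) (act β y ≟ᶠ y)
          | ⌊⌋-⇔ (Fixed-along σσ comm γ y) (act γ _ ≟ᶠ _) (act γ y ≟ᶠ y) = refl

  stab-α : ∀ y → stab (α· y) ≡ stab y
  stab-α = stab-along αα act-α-comm
  stab-β : ∀ y → stab (β· y) ≡ stab y
  stab-β = stab-along ββ act-β-comm
  stab-γ : ∀ y → stab (γ· y) ≡ stab y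
  stab-γ y = trans (stab-α (β· y)) (stab-β y)

  data Stabilizer (y : Fin n) : Subgroup → Set where
    stab-𝟙 : ¬ Fixed α y → ¬ Fixed β y → ¬ Fixed γ y → Stabilizer y 𝟙
    stab-⟨α⟩ : Fixed α y → ¬ Fixed β y → Stabilizer y ⟨α⟩
    stab-⟨β⟩ : ¬ Fixed α y → Fixed β y → Stabilizer y ⟨β⟩
    stab-⟨γ⟩ : ¬ Fixed α y → ¬ Fixed β y → Fixed γ y → Stabilizer y ⟨γ⟩
    stab-𝔾 : Fixed α y → Fixed β y → Stabilizer y 𝔾

  stabilizer : ∀ y → Stabilizer y (stab y)
  stabilizer y with act α y ≟ᶠ y | act β y ≟ᶠ y | act γ y ≟ᶠ y
  ... | yes a | yes b | _     = stab-𝔾 a b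
  ... | yes a | no b  | _     = stab-⟨α⟩ a b
  ... | no a  | yes b | _     = stab-⟨β⟩ a b
  ... | no a  | no b  | yes c = stab-⟨γ⟩ a b c
  ... | no a  | no b  | no c  = stab-𝟙 a b c

  regular-distinct : ∀ {y} → ¬ Fixed α y → ¬ Fixed β y → ¬ Fixed γ y →
    (y ≢ α· y) × (y ≢ β· y) × (y ≢ γ· y) × (α· y ≢ β· y) × (α· y ≢ γ· y) × (β· y ≢ γ· y)
  regular-distinct {y} a b c =
      a ∘ sym , b ∘ sym , c ∘ sym
    , (λ e → c (trans (cong actα (sym e)) (αα y)))
    , b ∘ sym ∘ α-injective
    , (λ e → a (Equivalence.to (Fixed-along ββ act-β-comm α y) (sym e)))

  orbitLength≡index : ∀ y → orbitLength y ≡ index (stab y)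
  orbitLength≡index y with stab y | stabilizer y
  ... | 𝟙 | stab-𝟙 a b c =
    let (y≢αy , y≢βy , y≢γy , αy≢βy , αy≢γy , βy≢γy) = regular-distinct a b c
    in distinct-abcd _≟ᶠ_ y≢αy y≢βy y≢γy αy≢βy αy≢γy βy≢γy
  ... | ⟨α⟩ | stab-⟨α⟩ a b =
    trans (cong (λ (u , v) → distinct _≟ᶠ_ (y ∷ u ∷ β· y ∷ v ∷ [])) (cong₂ _,_ a (trans (αβ y) (cong actβ a))))
          (distinct-aabb _≟ᶠ_ (b ∘ sym))
  ... | ⟨β⟩ | stab-⟨β⟩ a b =
    trans (cong (λ (u , v) → distinct _≟ᶠ_ (y ∷ α· y ∷ u ∷ v ∷ [])) (cong₂ _,_ b (cong actα b)))
          (distinct-abab _≟ᶠ_ (a ∘ sym))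
  ... | ⟨γ⟩ | stab-⟨γ⟩ a b c =
    trans (cong (λ (u , v) → distinct _≟ᶠ_ (y ∷ α· y ∷ u ∷ v ∷ [])) (cong₂ _,_ (trans (sym (αγ≡β y)) (cong actα c)) c))
          (distinct-abba _≟ᶠ_ (a ∘ sym))
  ... | 𝔾 | stab-𝔾 a b =
    trans (cong (λ (u , v , w) → distinct _≟ᶠ_ (y ∷ u ∷ v ∷ w ∷ [])) (cong₂ _,_ a (cong₂ _,_ b (trans (cong actα b) a))))
          (distinct-aaaa _≟ᶠ_ y)

  fixes≡∋ : ∀ δ y → fixes δ y ≡ stab y ∋ δ
  fixes≡∋ one y = ⌊⌋-yes (y ≟ᶠ y) refl
  fixes≡∋ α y with stab y | stabilizer y
  fixes≡∋ α y | 𝟙 | stab-𝟙 a _ _ = ⌊⌋-no (_ ≟ᶠ _) a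
  fixes≡∋ α y | ⟨α⟩ | stab-⟨α⟩ a _ = ⌊⌋-yes (_ ≟ᶠ _) a
  fixes≡∋ α y | ⟨β⟩ | stab-⟨β⟩ a _ = ⌊⌋-no (_ ≟ᶠ _) a
  fixes≡∋ α y | ⟨γ⟩ | stab-⟨γ⟩ a _ _ = ⌊⌋-no (_ ≟ᶠ _) a
  fixes≡∋ α y | 𝔾 | stab-𝔾 a _ = ⌊⌋-yes (_ ≟ᶠ _) a
  fixes≡∋ β y with stab y | stabilizer y
  fixes≡∋ β y | 𝟙 | stab-𝟙 _ b _ = ⌊⌋-no (_ ≟ᶠ _) b
  fixes≡∋ β y | ⟨α⟩ | stab-⟨α⟩ _ b = ⌊⌋-no (_ ≟ᶠ _) b
  fixes≡∋ β y | ⟨β⟩ | stab-⟨β⟩ _ b = ⌊⌋-yes (_ ≟ᶠ _) b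
  fixes≡∋ β y | ⟨γ⟩ | stab-⟨γ⟩ _ b _ = ⌊⌋-no (_ ≟ᶠ _) b
  fixes≡∋ β y | 𝔾 | stab-𝔾 _ b = ⌊⌋-yes (_ ≟ᶠ _) b
  fixes≡∋ γ y with stab y | stabilizer y
  fixes≡∋ γ y | 𝟙 | stab-𝟙 _ _ c = ⌊⌋-no (_ ≟ᶠ _) c
  fixes≡∋ γ y | ⟨α⟩ | stab-⟨α⟩ a b = ⌊⌋-no (_ ≟ᶠ _) (λ c → b (trans (sym (trans (αβ y) (cong actβ a))) c))
  fixes≡∋ γ y | ⟨β⟩ | stab-⟨β⟩ a b = ⌊⌋-no (_ ≟ᶠ _) (λ c → a (trans (sym (cong actα b)) c))
  fixes≡∋ γ y | ⟨γ⟩ | stab-⟨γ⟩ _ _ c = ⌊⌋-yes (_ ≟ᶠ _) c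
  fixes≡∋ γ y | 𝔾 | stab-𝔾 a b = ⌊⌋-yes (_ ≟ᶠ _) (trans (cong actα b) a)

  trivialOnOrbit≡∋ : ∀ δ y → trivialOnOrbit δ y ≡ stab y ∋ δ
  trivialOnOrbit≡∋ δ y =
    trans (cong₂ (λ u v → fixes δ y ∧ (u ∧ v)) (at (α· y) (stab-α y)) (cong₂ _∧_ (at (β· y) (stab-β y)) (cong (_∧ true) (at (γ· y) (stab-γ y)))))
          (trans (idem (fixes δ y)) (fixes≡∋ δ y))
    where
    at : ∀ z → stab z ≡ stab y → fixes δ z ≡ fixes δ y
    at z e = trans (fixes≡∋ δ z) (trans (cong (_∋ δ) e) (sym (fixes≡∋ δ y)))
    idem : ∀ b → b ∧ (b ∧ (b ∧ (b ∧ true))) ≡ b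
    idem true = refl
    idem false = refl

  ofType : Subgroup → Fin n → Bool
  ofType H y = stab y == H

  stabilizer-of : ∀ {y H} → stab y ≡ H → Stabilizer y H
  stabilizer-of {y} e = subst (Stabilizer y) e (stabilizer y)

  private
    hasLength≡ : ∀ k y → hasLength k y ≡ ⌊ index (stab y) ≟ k ⌋
    hasLength≡ k y = cong (λ m → ⌊ m ≟ k ⌋) (orbitLength≡index y)

    lengthTwo : Klein → Subgroup → Bool
    lengthTwo δ H = ⌊ index H ≟ 2 ⌋ ∧ H ∋ δ

    by-subgroup : ∀ H →
      (⌊ index H ≟ 4 ⌋ ≡ H == 𝟙) × (lengthTwo α H ≡ H == ⟨α⟩) × (lengthTwo β H ≡ H == ⟨β⟩) ×
      (lengthTwo γ H ≡ H == ⟨γ⟩) × (⌊ index H ≟ 1 ⌋ ≡ H == 𝔾)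
    by-subgroup 𝟙 = refl , refl , refl , refl , refl
    by-subgroup ⟨α⟩ = refl , refl , refl , refl , refl
    by-subgroup ⟨β⟩ = refl , refl , refl , refl , refl
    by-subgroup ⟨γ⟩ = refl , refl , refl , refl , refl
    by-subgroup 𝔾 = refl , refl , refl , refl , refl

    lengthTwo≡ : ∀ δ y → hasLength 2 y ∧ trivialOnOrbit δ y ≡ lengthTwo δ (stab y)
    lengthTwo≡ δ y = cong₂ _∧_ (hasLength≡ 2 y) (trivialOnOrbit≡∋ δ y)

  hasLength4≡ : ∀ y → hasLength 4 y ≡ ofType 𝟙 y
  hasLength4≡ y = trans (hasLength≡ 4 y) (proj₁ (by-subgroup (stab y)))

  inXα≡ : ∀ y → hasLength 2 y ∧ trivialOnOrbit α y ≡ ofType ⟨α⟩ y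
  inXα≡ y = trans (lengthTwo≡ α y) (proj₁ (proj₂ (by-subgroup (stab y))))

  inXβ≡ : ∀ y → hasLength 2 y ∧ trivialOnOrbit β y ≡ ofType ⟨β⟩ y
  inXβ≡ y = trans (lengthTwo≡ β y) (proj₁ (proj₂ (proj₂ (by-subgroup (stab y)))))

  inXγ≡ : ∀ y → hasLength 2 y ∧ trivialOnOrbit γ y ≡ ofType ⟨γ⟩ y
  inXγ≡ y = trans (lengthTwo≡ γ y) (proj₁ (proj₂ (proj₂ (proj₂ (by-subgroup (stab y))))))

  hasLength1≡ : ∀ y → hasLength 1 y ≡ ofType 𝔾 y
  hasLength1≡ y = trans (hasLength≡ 1 y) (proj₂ (proj₂ (proj₂ (proj₂ (by-subgroup (stab y))))))

  private
    isRep-at : ∀ z {a b c} → α· z ≡ a → β· z ≡ b → γ· z ≡ c →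
      isRep z ≡ true ⇔ LowerBound (toℕ z) (toℕ z) (toℕ a) (toℕ b) (toℕ c)
    isRep-at z refl refl refl = lowerBound?⇔

    ⇔-via : ∀ {B P Q : Set} → (P → Q) → (Q → P) → B ⇔ P → B ⇔ Q
    ⇔-via f g B⇔P = mk⇔ (f ∘ Equivalence.to B⇔P) (Equivalence.from B⇔P ∘ g)

    toℕ-≢ : ∀ {x y : Fin n} → x ≢ y → toℕ x ≢ toℕ y
    toℕ-≢ x≢y = x≢y ∘ toℕ-injective

  one-rep-in-regular-orbit : ∀ {y} → stab y ≡ 𝟙 →
    𝕀 (isRep y) + 𝕀 (isRep (α· y)) + 𝕀 (isRep (β· y)) + 𝕀 (isRep (γ· y)) ≡ 1
  one-rep-in-regular-orbit {y} e with stabilizer-of e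
  ... | stab-𝟙 a b c =
    let (y≢αy , y≢βy , y≢γy , αy≢βy , αy≢γy , βy≢γy) = regular-distinct a b c
    in exactly-one-least-of-four
         (isRep-at y refl refl refl)
         (⇔-via LowerBound-2143 LowerBound-2143 (isRep-at (α· y) (αα y) (βα≡γ y) (γα≡β y)))
         (⇔-via LowerBound-3412 LowerBound-3412 (isRep-at (β· y) refl (ββ y) (γβ≡α y)))
         (⇔-via LowerBound-4321 LowerBound-4321 (isRep-at (γ· y) (αγ≡β y) (βγ≡α y) (γγ y)))
         (toℕ-≢ y≢αy) (toℕ-≢ y≢βy) (toℕ-≢ y≢γy) (toℕ-≢ αy≢βy) (toℕ-≢ αy≢γy) (toℕ-≢ βy≢γy)

  one-rep-in-⟨α⟩-orbit : ∀ {y} → stab y ≡ ⟨α⟩ → 𝕀 (isRep y) + 𝕀 (isRep (β· y)) ≡ 1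
  one-rep-in-⟨α⟩-orbit {y} e with stabilizer-of e
  ... | stab-⟨α⟩ a b =
    let γy≡βy = trans (αβ y) (cong actβ a)
    in exactly-one-least-of-two
         (⇔-via (to LowerBound-aabb) (from LowerBound-aabb) (isRep-at y a refl γy≡βy))
         (⇔-via (to LowerBound-aabb) (from LowerBound-aabb) (isRep-at (β· y) γy≡βy (ββ y) (trans (γβ≡α y) a)))
         (toℕ-≢ (b ∘ sym))
    where open Equivalence

  one-rep-in-⟨β⟩-orbit : ∀ {y} → stab y ≡ ⟨β⟩ → 𝕀 (isRep y) + 𝕀 (isRep (α· y)) ≡ 1
  one-rep-in-⟨β⟩-orbit {y} e with stabilizer-of e
  ... | stab-⟨β⟩ a b =
    exactly-one-least-of-two
      (⇔-via (to LowerBound-abab) (from LowerBound-abab) (isRep-at y refl b (cong actα b)))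
      (⇔-via (to LowerBound-abab) (from LowerBound-abab) (isRep-at (α· y) (αα y) (trans (βα≡γ y) (cong actα b)) (trans (γα≡β y) b)))
      (toℕ-≢ (a ∘ sym))
    where open Equivalence

  one-rep-in-⟨γ⟩-orbit : ∀ {y} → stab y ≡ ⟨γ⟩ → 𝕀 (isRep y) + 𝕀 (isRep (α· y)) ≡ 1
  one-rep-in-⟨γ⟩-orbit {y} e with stabilizer-of e
  ... | stab-⟨γ⟩ a b c =
    let βy≡αy = trans (sym (αγ≡β y)) (cong actα c)
    in exactly-one-least-of-two
         (⇔-via (to LowerBound-abba) (from LowerBound-abba) (isRep-at y refl βy≡αy c))
         (⇔-via (to LowerBound-abba) (from LowerBound-abba) (isRep-at (α· y) (αα y) (trans (βα≡γ y) c) (trans (γα≡β y) βy≡αy)))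
         (toℕ-≢ (a ∘ sym))
    where open Equivalence

  fixed-point-is-rep : ∀ {y} → stab y ≡ 𝔾 → isRep y ≡ true
  fixed-point-is-rep {y} e with stabilizer-of e
  ... | stab-𝔾 a b = Equivalence.from (isRep-at y a b (trans (cong actα b) a)) (≤-refl , ≤-refl , ≤-refl , ≤-refl)

  private
    rest-false : ∀ {a b c} → 𝕀 true + 𝕀 a + 𝕀 b + 𝕀 c ≡ 1 → a ≡ false × b ≡ false × c ≡ false
    rest-false {a} {b} {c} e =
      let abc = suc-injective e
      in 𝕀≡0 (m+n≡0⇒m≡0 (𝕀 a) (m+n≡0⇒m≡0 (𝕀 a + 𝕀 b) abc))
       , 𝕀≡0 (m+n≡0⇒n≡0 (𝕀 a) (m+n≡0⇒m≡0 (𝕀 a + 𝕀 b) abc))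
       , 𝕀≡0 (m+n≡0⇒n≡0 (𝕀 a + 𝕀 b) abc)

  regular-rep-unique : ∀ {y} → stab y ≡ 𝟙 → isRep y ≡ true →
    isRep (α· y) ≡ false × isRep (β· y) ≡ false × isRep (γ· y) ≡ false
  regular-rep-unique {y} e rep =
    rest-false (subst (λ b → 𝕀 b + 𝕀 (isRep (α· y)) + 𝕀 (isRep (β· y)) + 𝕀 (isRep (γ· y)) ≡ 1) rep (one-rep-in-regular-orbit e))

  pair-rep-unique : ∀ {y z} → 𝕀 (isRep y) + 𝕀 (isRep z) ≡ 1 → isRep y ≡ true → isRep z ≡ false
  pair-rep-unique {y} {z} sum≡1 rep = 𝕀≡0 (suc-injective (subst (λ b → 𝕀 b + 𝕀 (isRep z) ≡ 1) rep sum≡1))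

  module _ (P : Fin n → Bool) (ρ : Fin n → ℕ) where

    sumOn-by-pairs : ∀ {σ : Fin n → Fin n} → (∀ y → σ (σ y) ≡ y) → (∀ y → P (σ y) ≡ P y) →
      (∀ y → P y ≡ true → ρ y + ρ (σ y) ≡ 1) →
      ∀ F → sumOn P F ≡ sumOn P (λ y → ρ y * (F y + F (σ y)))
    sumOn-by-pairs {σ} σσ Pσ ρ-sums-to-1 F = sym (begin
      sumOn P (λ y → ρ y * (F y + F (σ y)))
        ≡⟨ sumOn-cong P (λ y _ → *-distribˡ-+ (ρ y) (F y) (F (σ y))) ⟩
      sumOn P (λ y → ρ y * F y + ρ y * F (σ y))
        ≡⟨ sumOn-+ P (λ y → ρ y * F y) (λ y → ρ y * F (σ y)) ⟩
      sumOn P (λ y → ρ y * F y) + sumOn P (λ y → ρ y * F (σ y))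
        ≡⟨ cong (λ m → sumOn P (λ y → ρ y * F y) + m) (sumOn-shift P σσ Pσ ρ F) ⟩
      sumOn P (λ y → ρ y * F y) + sumOn P (λ y → ρ (σ y) * F y)
        ≡⟨ sumOn-+ P (λ y → ρ y * F y) (λ y → ρ (σ y) * F y) ⟨
      sumOn P (λ y → ρ y * F y + ρ (σ y) * F y)
        ≡⟨ sumOn-cong P collapse ⟩
      sumOn P F ∎)
      where
      open ≡-Reasoning
      collapse : ∀ y → P y ≡ true → ρ y * F y + ρ (σ y) * F y ≡ F y
      collapse y Py = begin
        ρ y * F y + ρ (σ y) * F y ≡⟨ *-distribʳ-+ (F y) (ρ y) (ρ (σ y)) ⟨
        (ρ y + ρ (σ y)) * F y     ≡⟨ cong (_* F y) (ρ-sums-to-1 y Py) ⟩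
        1 * F y                   ≡⟨ *-identityˡ (F y) ⟩
        F y                       ∎

    sumOn-by-orbits : (∀ y → P (α· y) ≡ P y) → (∀ y → P (β· y) ≡ P y) →
      (∀ y → P y ≡ true → ρ y + ρ (α· y) + ρ (β· y) + ρ (γ· y) ≡ 1) →
      ∀ F → sumOn P F ≡ sumOn P (λ y → ρ y * (F y + F (α· y) + F (β· y) + F (γ· y)))
    sumOn-by-orbits Pα Pβ ρ-sums-to-1 F = sym (begin
      sumOn P (λ y → ρ y * (F y + F (α· y) + F (β· y) + F (γ· y)))
        ≡⟨ sumOn-cong P (λ y _ → distrib (ρ y) (F y) (F (α· y)) (F (β· y)) (F (γ· y))) ⟩
      sumOn P (λ y → ρ y * F y + ρ y * F (α· y) + ρ y * F (β· y) + ρ y * F (γ· y))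
        ≡⟨ sumOn-+₄ (λ y → ρ y * F y) (λ y → ρ y * F (α· y)) (λ y → ρ y * F (β· y)) (λ y → ρ y * F (γ· y)) ⟩
      sumOn P (λ y → ρ y * F y) + sumOn P (λ y → ρ y * F (α· y)) + sumOn P (λ y → ρ y * F (β· y)) + sumOn P (λ y → ρ y * F (γ· y))
        ≡⟨ cong₃ (λ u v w → sumOn P (λ y → ρ y * F y) + u + v + w)
                 (sumOn-shift P αα Pα ρ F) (sumOn-shift P ββ Pβ ρ F) (sumOn-shift P γγ Pγ ρ F) ⟩
      sumOn P (λ y → ρ y * F y) + sumOn P (λ y → ρ (α· y) * F y) + sumOn P (λ y → ρ (β· y) * F y) + sumOn P (λ y → ρ (γ· y) * F y)
        ≡⟨ sumOn-+₄ (λ y → ρ y * F y) (λ y → ρ (α· y) * F y) (λ y → ρ (β· y) * F y) (λ y → ρ (γ· y) * F y) ⟨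
      sumOn P (λ y → ρ y * F y + ρ (α· y) * F y + ρ (β· y) * F y + ρ (γ· y) * F y)
        ≡⟨ sumOn-cong P collapse ⟩
      sumOn P F ∎)
      where
      open ≡-Reasoning
      Pγ : ∀ y → P (γ· y) ≡ P y
      Pγ y = trans (Pα (β· y)) (Pβ y)
      distrib : ∀ r a b c d → r * (a + b + c + d) ≡ r * a + r * b + r * c + r * d
      distrib = solve-∀
      factor : ∀ r s t u x → r * x + s * x + t * x + u * x ≡ (r + s + t + u) * x
      factor = solve-∀
      sumOn-+₄ : ∀ (F₁ F₂ F₃ F₄ : Fin n → ℕ) →
        sumOn P (λ y → F₁ y + F₂ y + F₃ y + F₄ y) ≡ sumOn P F₁ + sumOn P F₂ + sumOn P F₃ + sumOn P F₄
      sumOn-+₄ F₁ F₂ F₃ F₄ =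
        trans (sumOn-+ P (λ y → F₁ y + F₂ y + F₃ y) F₄)
              (cong (_+ sumOn P F₄) (trans (sumOn-+ P (λ y → F₁ y + F₂ y) F₃) (cong (_+ sumOn P F₃) (sumOn-+ P F₁ F₂))))
      collapse : ∀ y → P y ≡ true → ρ y * F y + ρ (α· y) * F y + ρ (β· y) * F y + ρ (γ· y) * F y ≡ F y
      collapse y Py = trans (factor (ρ y) (ρ (α· y)) (ρ (β· y)) (ρ (γ· y)) (F y))
                            (trans (cong (_* F y) (ρ-sums-to-1 y Py)) (*-identityˡ (F y)))

  ofType-α : ∀ H y → ofType H (α· y) ≡ ofType H y
  ofType-α H y = cong (_== H) (stab-α y)

  ofType-β : ∀ H y → ofType H (β· y) ≡ ofType H y
  ofType-β H y = cong (_== H) (stab-β y)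

  ofType-γ : ∀ H y → ofType H (γ· y) ≡ ofType H y
  ofType-γ H y = cong (_== H) (stab-γ y)

  repsOn : Subgroup → (Fin n → ℕ) → ℕ
  repsOn H F = sumOn (ofType H) (λ y → 𝕀 (isRep y) * F y)

  sum-over-regular-orbits : ∀ F → sumOn (ofType 𝟙) F ≡ repsOn 𝟙 (λ y → F y + F (α· y) + F (β· y) + F (γ· y))
  sum-over-regular-orbits = sumOn-by-orbits (ofType 𝟙) (𝕀 ∘ isRep) (ofType-α 𝟙) (ofType-β 𝟙)
    (λ y e → one-rep-in-regular-orbit (==-sound e))

  sum-over-⟨α⟩-orbits : ∀ F → sumOn (ofType ⟨α⟩) F ≡ repsOn ⟨α⟩ (λ y → F y + F (β· y))
  sum-over-⟨α⟩-orbits = sumOn-by-pairs (ofType ⟨α⟩) (𝕀 ∘ isRep) ββ (ofType-β ⟨α⟩)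
    (λ y e → one-rep-in-⟨α⟩-orbit (==-sound e))

  sum-over-⟨β⟩-orbits : ∀ F → sumOn (ofType ⟨β⟩) F ≡ repsOn ⟨β⟩ (λ y → F y + F (α· y))
  sum-over-⟨β⟩-orbits = sumOn-by-pairs (ofType ⟨β⟩) (𝕀 ∘ isRep) αα (ofType-α ⟨β⟩)
    (λ y e → one-rep-in-⟨β⟩-orbit (==-sound e))

  sum-over-⟨γ⟩-orbits : ∀ F → sumOn (ofType ⟨γ⟩) F ≡ repsOn ⟨γ⟩ (λ y → F y + F (α· y))
  sum-over-⟨γ⟩-orbits = sumOn-by-pairs (ofType ⟨γ⟩) (𝕀 ∘ isRep) αα (ofType-α ⟨γ⟩)
    (λ y e → one-rep-in-⟨γ⟩-orbit (==-sound e))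

  sum-over-fixed-points : ∀ F → sumOn (ofType 𝔾) F ≡ repsOn 𝔾 F
  sum-over-fixed-points F = sumOn-cong (ofType 𝔾) rep-weight
    where
    rep-weight : ∀ y → ofType 𝔾 y ≡ true → F y ≡ 𝕀 (isRep y) * F y
    rep-weight y e rewrite fixed-point-is-rep (==-sound e) = sym (+-identityʳ (F y))

  orbits : Subgroup → ℕ
  orbits H = repsOn H (λ _ → 1)

  numOrbits≡orbits : ∀ {P} H → (∀ y → P y ≡ ofType H y) → numOrbits A P ≡ orbits H
  numOrbits≡orbits {P} H P≡ = trans (count≡∑ (λ x → isRep x ∧ P x)) (sum-cong-≗ pointwise)
    where
    pointwise : ∀ y → 𝕀 (isRep y ∧ P y) ≡ 𝕀 (ofType H y) * (𝕀 (isRep y) * 1)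
    pointwise y rewrite P≡ y with isRep y | ofType H y
    ... | true | true = refl
    ... | true | false = refl
    ... | false | true = refl
    ... | false | false = refl

  s#≡orbits : s# A ≡ orbits 𝟙
  s#≡orbits = numOrbits≡orbits 𝟙 hasLength4≡

  p#≡orbits : p# A ≡ orbits ⟨α⟩
  p#≡orbits = numOrbits≡orbits ⟨α⟩ inXα≡

  q#≡orbits : q# A ≡ orbits ⟨β⟩
  q#≡orbits = numOrbits≡orbits ⟨β⟩ inXβ≡

  r#≡orbits : r# A ≡ orbits ⟨γ⟩
  r#≡orbits = numOrbits≡orbits ⟨γ⟩ inXγ≡

  t#≡orbits : t# A ≡ orbits 𝔾
  t#≡orbits = numOrbits≡orbits 𝔾 hasLength1≡

  nonFree≡ : ∀ y → nonFree A y ≡ not (ofType 𝟙 y)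
  nonFree≡ y = cong not (hasLength4≡ y)

  sum-split : ∀ F → sum F ≡ sumOn (ofType 𝟙) F + sumOn (nonFree A) F
  sum-split F = trans (sym (sumOn-true F)) (sumOn-split (ofType 𝟙) (nonFree A) one-or-other F)
    where
    one-or-other : ∀ y → 𝕀 true ≡ 𝕀 (ofType 𝟙 y) + 𝕀 (nonFree A y)
    one-or-other y rewrite nonFree≡ y with ofType 𝟙 y
    ... | true = refl
    ... | false = refl

  sumOn-nonFree : ∀ F → sumOn (nonFree A) F ≡
    sumOn (ofType ⟨α⟩) F + sumOn (ofType ⟨β⟩) F + sumOn (ofType ⟨γ⟩) F + sumOn (ofType 𝔾) F
  sumOn-nonFree = sumOn-split₄ (ofType ⟨α⟩) (ofType ⟨β⟩) (ofType ⟨γ⟩) (ofType 𝔾) nonFree-types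
    where
    nonFree-types : ∀ y → 𝕀 (nonFree A y) ≡
      𝕀 (ofType ⟨α⟩ y) + 𝕀 (ofType ⟨β⟩ y) + 𝕀 (ofType ⟨γ⟩ y) + 𝕀 (ofType 𝔾 y)
    nonFree-types y rewrite nonFree≡ y with stab y
    ... | 𝟙 = refl
    ... | ⟨α⟩ = refl
    ... | ⟨β⟩ = refl
    ... | ⟨γ⟩ = refl
    ... | 𝔾 = refl

  private
    count≡sumOn : (P : Fin n → Bool) → count P ≡ sumOn P (λ _ → 1)
    count≡sumOn P = trans (count≡∑ P) (sum-cong-≗ (λ y → sym (*-identityʳ (𝕀 (P y)))))

    repsOn-const : ∀ H k → repsOn H (λ _ → k) ≡ k * orbits H
    repsOn-const H k = trans (sumOn-cong (ofType H) (λ y _ → r*k≡k*[r*1] (𝕀 (isRep y)) k))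
                             (sumOn-*ˡ (ofType H) k (λ y → 𝕀 (isRep y) * 1))
      where
      r*k≡k*[r*1] : ∀ r k → r * k ≡ k * (r * 1)
      r*k≡k*[r*1] = solve-∀

  v₀ : ℕ
  v₀ = 2 * orbits ⟨α⟩ + 2 * orbits ⟨β⟩ + 2 * orbits ⟨γ⟩ + orbits 𝔾

  count-nonFree : count (nonFree A) ≡ v₀
  count-nonFree = begin
    count (nonFree A)                    ≡⟨ count≡sumOn (nonFree A) ⟩
    sumOn (nonFree A) (λ _ → 1)          ≡⟨ sumOn-nonFree (λ _ → 1) ⟩
    sumOn (ofType ⟨α⟩) (λ _ → 1) + sumOn (ofType ⟨β⟩) (λ _ → 1) + sumOn (ofType ⟨γ⟩) (λ _ → 1) + sumOn (ofType 𝔾) (λ _ → 1)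
      ≡⟨ cong₂ _+_ (cong₃ (λ u v w → u + v + w)
           (trans (sum-over-⟨α⟩-orbits (λ _ → 1)) (repsOn-const ⟨α⟩ 2))
           (trans (sum-over-⟨β⟩-orbits (λ _ → 1)) (repsOn-const ⟨β⟩ 2))
           (trans (sum-over-⟨γ⟩-orbits (λ _ → 1)) (repsOn-const ⟨γ⟩ 2)))
           (trans (sum-over-fixed-points (λ _ → 1)) (trans (repsOn-const 𝔾 1) (*-identityˡ _))) ⟩
    2 * orbits ⟨α⟩ + 2 * orbits ⟨β⟩ + 2 * orbits ⟨γ⟩ + orbits 𝔾 ∎
    where open ≡-Reasoning

  count-everything : count (everything A) ≡ 4 * orbits 𝟙 + v₀
  count-everything = begin
    count (everything A)                                       ≡⟨ count≡∑ (everything A) ⟩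
    sum {n} (λ _ → 1)                                          ≡⟨ sum-split (λ _ → 1) ⟩
    sumOn (ofType 𝟙) (λ _ → 1) + sumOn (nonFree A) (λ _ → 1)   ≡⟨ cong₂ _+_ regular (trans (sym (count≡sumOn (nonFree A))) count-nonFree) ⟩
    4 * orbits 𝟙 + v₀                                          ∎
    where
    open ≡-Reasoning
    regular : sumOn (ofType 𝟙) (λ _ → 1) ≡ 4 * orbits 𝟙
    regular = trans (sum-over-regular-orbits (λ _ → 1)) (repsOn-const 𝟙 4)

  private
    repsOn-cong : ∀ H {F G : Fin n → ℕ} → (∀ y → ofType H y ≡ true → F y ≡ G y) → repsOn H F ≡ repsOn H G
    repsOn-cong H F≡G = sumOn-cong (ofType H) (λ y e → cong (𝕀 (isRep y) *_) (F≡G y e))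

    repsOn-+ : ∀ H (F G : Fin n → ℕ) → repsOn H (λ y → F y + G y) ≡ repsOn H F + repsOn H G
    repsOn-+ H F G = trans (sumOn-cong (ofType H) (λ y _ → *-distribˡ-+ (𝕀 (isRep y)) (F y) (G y)))
                           (sumOn-+ (ofType H) (λ y → 𝕀 (isRep y) * F y) (λ y → 𝕀 (isRep y) * G y))

    repsOn-*ˡ : ∀ H k (F : Fin n → ℕ) → repsOn H (λ y → k * F y) ≡ k * repsOn H F
    repsOn-*ˡ H k F = trans (sumOn-cong (ofType H) (λ y _ → r*[k*f]≡k*[r*f] (𝕀 (isRep y)) k (F y)))
                            (sumOn-*ˡ (ofType H) k (λ y → 𝕀 (isRep y) * F y))
      where
      r*[k*f]≡k*[r*f] : ∀ r k f → r * (k * f) ≡ k * (r * f)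
      r*[k*f]≡k*[r*f] = solve-∀

    repsOn-mono-≤ : ∀ H {F G : Fin n → ℕ} → (∀ y → F y ≤ G y) → repsOn H F ≤ repsOn H G
    repsOn-mono-≤ H F≤G = sumOn-mono-≤ (ofType H) (λ y → *-monoʳ-≤ (𝕀 (isRep y)) (F≤G y))

  sum-over-regular-orbits-weighted : ∀ (F X Y Z : Fin n → ℕ) →
    (∀ y → F y + F (α· y) + F (β· y) + F (γ· y) ≡ 2 * (X y + 2 * Y y + 2 * Z y)) →
    sumOn (ofType 𝟙) F ≡ 2 * (repsOn 𝟙 X + 2 * repsOn 𝟙 Y + 2 * repsOn 𝟙 Z)
  sum-over-regular-orbits-weighted F X Y Z orbit-sum = begin
    sumOn (ofType 𝟙) F                                            ≡⟨ sum-over-regular-orbits F ⟩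
    repsOn 𝟙 (λ y → F y + F (α· y) + F (β· y) + F (γ· y))         ≡⟨ repsOn-cong 𝟙 (λ y _ → orbit-sum y) ⟩
    repsOn 𝟙 (λ y → 2 * (X y + 2 * Y y + 2 * Z y))                ≡⟨ repsOn-*ˡ 𝟙 2 _ ⟩
    2 * repsOn 𝟙 (λ y → X y + 2 * Y y + 2 * Z y)
      ≡⟨ cong (2 *_) (trans (repsOn-+ 𝟙 (λ y → X y + 2 * Y y) (λ y → 2 * Z y))
                     (cong₂ _+_ (trans (repsOn-+ 𝟙 X (λ y → 2 * Y y)) (cong (λ m → repsOn 𝟙 X + m) (repsOn-*ˡ 𝟙 2 Y)))
                                (repsOn-*ˡ 𝟙 2 Z))) ⟩
    2 * (repsOn 𝟙 X + 2 * repsOn 𝟙 Y + 2 * repsOn 𝟙 Z)            ∎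
    where open ≡-Reasoning

  sum-over-pair-orbits-invariant : ∀ H {σ : Fin n → Fin n} (F : Fin n → ℕ) →
    sumOn (ofType H) F ≡ repsOn H (λ y → F y + F (σ y)) → (∀ y → F (σ y) ≡ F y) →
    sumOn (ofType H) F ≡ 2 * repsOn H F
  sum-over-pair-orbits-invariant H {σ} F by-pairs Fσ =
    trans by-pairs (trans (repsOn-cong H (λ y _ → trans (cong (λ m → F y + m) (Fσ y)) (double (F y))))
                          (repsOn-*ˡ H 2 F))
    where
    double : ∀ x → x + x ≡ 2 * x
    double = solve-∀

  Fixed-in : ∀ {H y} δ → ofType H y ≡ true → H ∋ δ ≡ true → Fixed δ y
  Fixed-in {H} {y} δ e H∋δ with act δ y ≟ᶠ y | fixes≡∋ δ y
  ... | yes fixed | _ = fixed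
  ... | no _ | fixes≡ with () ← trans fixes≡ (trans (cong (_∋ δ) (==-sound e)) H∋δ)

  module _ (g : Fin n → Bool) where

    D : Klein → Fin n → Bool
    D δ w = g (act δ w) xor g w

    typeAt : Fin n → FreeOrbitType
    typeAt y = freeOrbitType (D α y) (D β y) (D γ y)

    profileOf : Profile
    profileOf = profile
      (repsOn 𝟙 (𝕀 ∘ isOdd ∘ typeAt)) (repsOn 𝟙 (𝕀 ∘ isSplitα ∘ typeAt))
      (repsOn 𝟙 (𝕀 ∘ isSplitβ ∘ typeAt)) (repsOn 𝟙 (𝕀 ∘ isSplitγ ∘ typeAt))
      (repsOn ⟨α⟩ (𝕀 ∘ D β)) (repsOn ⟨β⟩ (𝕀 ∘ D α)) (repsOn ⟨γ⟩ (𝕀 ∘ D α))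

    private
      D-fixed : ∀ δ {y} → Fixed δ y → 𝕀 (D δ y) ≡ 0
      D-fixed δ {y} e = cong 𝕀 (trans (cong (λ z → g z xor g y) e) (xor-same (g y)))

      D-same-image : ∀ δ ε {y} → act δ y ≡ act ε y → 𝕀 (D δ y) ≡ 𝕀 (D ε y)
      D-same-image δ ε {y} e = cong (λ z → 𝕀 (g z xor g y)) e

      D-involution : ∀ {δ} → (∀ y → act δ (act δ y) ≡ y) → ∀ y → 𝕀 (D δ (act δ y)) ≡ 𝕀 (D δ y)
      D-involution {δ} δδ y = cong 𝕀 (trans (cong (λ z → g z xor g (act δ y)) (δδ y)) (xor-comm (g y) (g (act δ y))))

      xor-relative : ∀ a b u → a xor b ≡ (a xor u) xor (b xor u)
      xor-relative a b u = sym (xor-cancelʳ a b u)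

    regular-orbit-α : ∀ y → let t = typeAt y in
      𝕀 (D α y) + 𝕀 (D α (α· y)) + 𝕀 (D α (β· y)) + 𝕀 (D α (γ· y)) ≡
      2 * (𝕀 (isOdd t) + 2 * 𝕀 (isSplitβ t) + 2 * 𝕀 (isSplitγ t))
    regular-orbit-α y = begin
      𝕀 (D α y) + 𝕀 (D α (α· y)) + 𝕀 (D α (β· y)) + 𝕀 (D α (γ· y))
        ≡⟨ cong₃ (λ u v w → 𝕀 (D α y) + u + v + w) (D-involution {α} αα y)
             (cong 𝕀 (trans (xor-comm (g (γ· y)) (g (β· y))) (xor-relative (g (β· y)) (g (γ· y)) (g y))))
             (cong 𝕀 (trans (cong (λ z → g z xor g (γ· y)) (αγ≡β y)) (xor-relative (g (β· y)) (g (γ· y)) (g y)))) ⟩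
      𝕀 (D α y) + 𝕀 (D α y) + 𝕀 (D β y xor D γ y) + 𝕀 (D β y xor D γ y)
        ≡⟨ pairs (𝕀 (D α y)) (𝕀 (D β y xor D γ y)) ⟩
      2 * (𝕀 (D α y) + 𝕀 (D β y xor D γ y))
        ≡⟨ cong (2 *_) (weightα (D α y) (D β y) (D γ y)) ⟩
      2 * (𝕀 (isOdd (typeAt y)) + 2 * 𝕀 (isSplitβ (typeAt y)) + 2 * 𝕀 (isSplitγ (typeAt y))) ∎
      where
      open ≡-Reasoning
      pairs : ∀ x z → x + x + z + z ≡ 2 * (x + z)
      pairs = solve-∀

    regular-orbit-β : ∀ y → let t = typeAt y in
      𝕀 (D β y) + 𝕀 (D β (α· y)) + 𝕀 (D β (β· y)) + 𝕀 (D β (γ· y)) ≡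
      2 * (𝕀 (isOdd t) + 2 * 𝕀 (isSplitα t) + 2 * 𝕀 (isSplitγ t))
    regular-orbit-β y = begin
      𝕀 (D β y) + 𝕀 (D β (α· y)) + 𝕀 (D β (β· y)) + 𝕀 (D β (γ· y))
        ≡⟨ cong₃ (λ u v w → 𝕀 (D β y) + u + v + w)
             (cong 𝕀 (trans (cong (λ z → g z xor g (α· y)) (βα≡γ y))
                     (trans (xor-comm (g (γ· y)) (g (α· y))) (xor-relative (g (α· y)) (g (γ· y)) (g y)))))
             (D-involution {β} ββ y)
             (cong 𝕀 (trans (cong (λ z → g z xor g (γ· y)) (βγ≡α y)) (xor-relative (g (α· y)) (g (γ· y)) (g y)))) ⟩
      𝕀 (D β y) + 𝕀 (D α y xor D γ y) + 𝕀 (D β y) + 𝕀 (D α y xor D γ y)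
        ≡⟨ pairs (𝕀 (D β y)) (𝕀 (D α y xor D γ y)) ⟩
      2 * (𝕀 (D β y) + 𝕀 (D α y xor D γ y))
        ≡⟨ cong (2 *_) (weightβ (D α y) (D β y) (D γ y)) ⟩
      2 * (𝕀 (isOdd (typeAt y)) + 2 * 𝕀 (isSplitα (typeAt y)) + 2 * 𝕀 (isSplitγ (typeAt y))) ∎
      where
      open ≡-Reasoning
      pairs : ∀ x z → x + z + x + z ≡ 2 * (x + z)
      pairs = solve-∀

    regular-orbit-γ : ∀ y → let t = typeAt y in
      𝕀 (D γ y) + 𝕀 (D γ (α· y)) + 𝕀 (D γ (β· y)) + 𝕀 (D γ (γ· y)) ≡
      2 * (𝕀 (isOdd t) + 2 * 𝕀 (isSplitα t) + 2 * 𝕀 (isSplitβ t))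
    regular-orbit-γ y = begin
      𝕀 (D γ y) + 𝕀 (D γ (α· y)) + 𝕀 (D γ (β· y)) + 𝕀 (D γ (γ· y))
        ≡⟨ cong₃ (λ u v w → 𝕀 (D γ y) + u + v + w)
             (cong 𝕀 (trans (cong (λ z → g z xor g (α· y)) (γα≡β y))
                     (trans (xor-comm (g (β· y)) (g (α· y))) (xor-relative (g (α· y)) (g (β· y)) (g y)))))
             (cong 𝕀 (trans (cong (λ z → g z xor g (β· y)) (γβ≡α y)) (xor-relative (g (α· y)) (g (β· y)) (g y))))
             (D-involution {γ} γγ y) ⟩
      𝕀 (D γ y) + 𝕀 (D α y xor D β y) + 𝕀 (D α y xor D β y) + 𝕀 (D γ y)
        ≡⟨ pairs (𝕀 (D γ y)) (𝕀 (D α y xor D β y)) ⟩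
      2 * (𝕀 (D γ y) + 𝕀 (D α y xor D β y))
        ≡⟨ cong (2 *_) (weightγ (D α y) (D β y) (D γ y)) ⟩
      2 * (𝕀 (isOdd (typeAt y)) + 2 * 𝕀 (isSplitα (typeAt y)) + 2 * 𝕀 (isSplitβ (typeAt y))) ∎
      where
      open ≡-Reasoning
      pairs : ∀ x z → x + z + z + x ≡ 2 * (x + z)
      pairs = solve-∀

    open Profile profileOf

    profileOf-admissible : Admissible (orbits 𝟙) (orbits ⟨α⟩) (orbits ⟨β⟩) (orbits ⟨γ⟩) profileOf
    profileOf-admissible = types≤ , indicator≤ ⟨α⟩ (D β) , indicator≤ ⟨β⟩ (D α) , indicator≤ ⟨γ⟩ (D α)
      where
      indicator≤ : ∀ H h → repsOn H (𝕀 ∘ h) ≤ orbits H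
      indicator≤ H h = repsOn-mono-≤ H (λ y → 𝕀≤1 (h y))
      X₁ X₂ X₃ X₄ : Fin n → ℕ
      X₁ = 𝕀 ∘ isOdd ∘ typeAt
      X₂ = 𝕀 ∘ isSplitα ∘ typeAt
      X₃ = 𝕀 ∘ isSplitβ ∘ typeAt
      X₄ = 𝕀 ∘ isSplitγ ∘ typeAt
      split : repsOn 𝟙 (λ y → X₁ y + X₂ y + X₃ y + X₄ y) ≡ a + cα + cβ + cγ
      split = trans (repsOn-+ 𝟙 (λ y → X₁ y + X₂ y + X₃ y) X₄)
                (cong (_+ cγ) (trans (repsOn-+ 𝟙 (λ y → X₁ y + X₂ y) X₃) (cong (_+ cβ) (repsOn-+ 𝟙 X₁ X₂))))
      types≤ : a + cα + cβ + cγ ≤ orbits 𝟙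
      types≤ = subst (_≤ orbits 𝟙) split (repsOn-mono-≤ 𝟙 (λ y → at-most-one-type (typeAt y)))

    private
      S : Subgroup → Klein → ℕ
      S H δ = sumOn (ofType H) (𝕀 ∘ D δ)

      vanishes : ∀ H δ → H ∋ δ ≡ true → S H δ ≡ 0
      vanishes H δ H∋δ = sumOn-zero (ofType H) (λ y e → D-fixed δ (Fixed-in δ e H∋δ))

      transfer : ∀ H δ ε → (∀ {y} → ofType H y ≡ true → act δ y ≡ act ε y) → S H δ ≡ S H ε
      transfer H δ ε same = sumOn-cong (ofType H) (λ y e → D-same-image δ ε (same e))

      twice-p₁ : S ⟨α⟩ β ≡ 2 * p₁
      twice-p₁ = sum-over-pair-orbits-invariant ⟨α⟩ (𝕀 ∘ D β) (sum-over-⟨α⟩-orbits _) (D-involution {β} ββ)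

      twice-q₁ : S ⟨β⟩ α ≡ 2 * q₁
      twice-q₁ = sum-over-pair-orbits-invariant ⟨β⟩ (𝕀 ∘ D α) (sum-over-⟨β⟩-orbits _) (D-involution {α} αα)

      twice-r₁ : S ⟨γ⟩ α ≡ 2 * r₁
      twice-r₁ = sum-over-pair-orbits-invariant ⟨γ⟩ (𝕀 ∘ D α) (sum-over-⟨γ⟩-orbits _) (D-involution {α} αα)

    nonFree-differences-α : sumOn (nonFree A) (𝕀 ∘ D α) ≡ 2 * (q₁ + r₁)
    nonFree-differences-α = begin
      sumOn (nonFree A) (𝕀 ∘ D α)         ≡⟨ sumOn-nonFree (𝕀 ∘ D α) ⟩
      S ⟨α⟩ α + S ⟨β⟩ α + S ⟨γ⟩ α + S 𝔾 α
        ≡⟨ cong₂ _+_ (cong₃ (λ u v w → u + v + w) (vanishes ⟨α⟩ α refl) twice-q₁ twice-r₁) (vanishes 𝔾 α refl) ⟩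
      0 + 2 * q₁ + 2 * r₁ + 0             ≡⟨ collect q₁ r₁ ⟩
      2 * (q₁ + r₁)                       ∎
      where
      open ≡-Reasoning
      collect : ∀ u v → 0 + 2 * u + 2 * v + 0 ≡ 2 * (u + v)
      collect = solve-∀

    nonFree-differences-β : sumOn (nonFree A) (𝕀 ∘ D β) ≡ 2 * (p₁ + r₁)
    nonFree-differences-β = begin
      sumOn (nonFree A) (𝕀 ∘ D β)         ≡⟨ sumOn-nonFree (𝕀 ∘ D β) ⟩
      S ⟨α⟩ β + S ⟨β⟩ β + S ⟨γ⟩ β + S 𝔾 β
        ≡⟨ cong₂ _+_ (cong₃ (λ u v w → u + v + w) twice-p₁ (vanishes ⟨β⟩ β refl)
                        (trans (transfer ⟨γ⟩ β α (λ e → β≡α-if-γ-fixes (Fixed-in γ e refl))) twice-r₁))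
                     (vanishes 𝔾 β refl) ⟩
      2 * p₁ + 0 + 2 * r₁ + 0             ≡⟨ collect p₁ r₁ ⟩
      2 * (p₁ + r₁)                       ∎
      where
      open ≡-Reasoning
      collect : ∀ u v → 2 * u + 0 + 2 * v + 0 ≡ 2 * (u + v)
      collect = solve-∀

    nonFree-differences-γ : sumOn (nonFree A) (𝕀 ∘ D γ) ≡ 2 * (p₁ + q₁)
    nonFree-differences-γ = begin
      sumOn (nonFree A) (𝕀 ∘ D γ)         ≡⟨ sumOn-nonFree (𝕀 ∘ D γ) ⟩
      S ⟨α⟩ γ + S ⟨β⟩ γ + S ⟨γ⟩ γ + S 𝔾 γ
        ≡⟨ cong₂ _+_ (cong₃ (λ u v w → u + v + w)
                        (trans (transfer ⟨α⟩ γ β (λ e → γ≡β-if-α-fixes (Fixed-in α e refl))) twice-p₁)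
                        (trans (transfer ⟨β⟩ γ α (λ e → γ≡α-if-β-fixes (Fixed-in β e refl))) twice-q₁)
                        (vanishes ⟨γ⟩ γ refl))
                     (vanishes 𝔾 γ refl) ⟩
      2 * p₁ + 2 * q₁ + 0 + 0             ≡⟨ collect p₁ q₁ ⟩
      2 * (p₁ + q₁)                       ∎
      where
      open ≡-Reasoning
      collect : ∀ u v → 2 * u + 2 * v + 0 + 0 ≡ 2 * (u + v)
      collect = solve-∀

    private
      differences : ∀ δ x y z u v →
        sumOn (ofType 𝟙) (𝕀 ∘ D δ) ≡ 2 * (x + 2 * y + 2 * z) → sumOn (nonFree A) (𝕀 ∘ D δ) ≡ 2 * (u + v) →
        sum (𝕀 ∘ D δ) ≡ 2 * (x + 2 * y + 2 * z + u + v)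
      differences δ x y z u v regular nonRegular =
        trans (sum-split (𝕀 ∘ D δ)) (trans (cong₂ _+_ regular nonRegular) (collect x y z u v))
        where
        collect : ∀ x y z u v → 2 * (x + 2 * y + 2 * z) + 2 * (u + v) ≡ 2 * (x + 2 * y + 2 * z + u + v)
        collect = solve-∀

    differences-α : sum (𝕀 ∘ D α) ≡ 2 * Δα
    differences-α = differences α a cβ cγ q₁ r₁
      (sum-over-regular-orbits-weighted (𝕀 ∘ D α) (𝕀 ∘ isOdd ∘ typeAt) (𝕀 ∘ isSplitβ ∘ typeAt) (𝕀 ∘ isSplitγ ∘ typeAt) regular-orbit-α)
      nonFree-differences-α

    differences-β : sum (𝕀 ∘ D β) ≡ 2 * Δβ
    differences-β = differences β a cα cγ p₁ r₁
      (sum-over-regular-orbits-weighted (𝕀 ∘ D β) (𝕀 ∘ isOdd ∘ typeAt) (𝕀 ∘ isSplitα ∘ typeAt) (𝕀 ∘ isSplitγ ∘ typeAt) regular-orbit-β)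
      nonFree-differences-β

    differences-γ : sum (𝕀 ∘ D γ) ≡ 2 * Δγ
    differences-γ = differences γ a cα cβ p₁ q₁
      (sum-over-regular-orbits-weighted (𝕀 ∘ D γ) (𝕀 ∘ isOdd ∘ typeAt) (𝕀 ∘ isSplitα ∘ typeAt) (𝕀 ∘ isSplitβ ∘ typeAt) regular-orbit-γ)
      nonFree-differences-γ

  count-differences : ∀ S g δ → count (λ w → S w ∧ ⌊ (g (act δ w) xor g w) ≟ᴮ true ⌋) ≡ sumOn S (𝕀 ∘ D g δ)
  count-differences S g δ = trans (count≡∑ (λ w → S w ∧ ⌊ D g δ w ≟ᴮ true ⌋)) (sum-cong-≗ pointwise)
    where
    pointwise : ∀ w → 𝕀 (S w ∧ ⌊ D g δ w ≟ᴮ true ⌋) ≡ 𝕀 (S w) * 𝕀 (D g δ w)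
    pointwise w = trans (cong (λ b → 𝕀 (S w ∧ b)) (⌊≟true⌋ (D g δ w))) (𝕀-∧ (S w) (D g δ w))

  IsGPN⇔ : ∀ S g → IsGPN A S g ⇔ (∀ δ → δ ≢ one → 2 * sumOn S (𝕀 ∘ D g δ) ≡ count S)
  IsGPN⇔ S g = mk⇔ balanced perfect
    where
    N : ℕ
    N = count S
    balanced : IsGPN A S g → ∀ δ → δ ≢ one → 2 * sumOn S (𝕀 ∘ D g δ) ≡ N
    balanced (2∣N , half) δ δ≢one =
      trans (cong (2 *_) (trans (sym (count-differences S g δ)) (half δ δ≢one true))) (m*[n/m]≡n 2∣N)
    perfect : (∀ δ → δ ≢ one → 2 * sumOn S (𝕀 ∘ D g δ) ≡ N) → IsGPN A S g
    perfect twice = 2∣N , half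
      where
      2∣N : 2 ∣ N
      2∣N = divides (sumOn S (𝕀 ∘ D g α)) (trans (sym (twice α λ ())) (*-comm 2 (sumOn S (𝕀 ∘ D g α))))
      half : ∀ δ → δ ≢ one → ∀ σ → count (λ w → S w ∧ ⌊ (g (act δ w) xor g w) ≟ᴮ σ ⌋) ≡ N / 2
      half δ δ≢one σ = trans (by-value σ) (sym N/2≡X)
        where
        X : ℕ
        X = sumOn S (𝕀 ∘ D g δ)
        N/2≡X : N / 2 ≡ X
        N/2≡X = trans (cong (_/ 2) (trans (sym (twice δ δ≢one)) (*-comm 2 X))) (m*n/n≡m X 2)
        by-value : ∀ σ → count (λ w → S w ∧ ⌊ (g (act δ w) xor g w) ≟ᴮ σ ⌋) ≡ X
        by-value true = count-differences S g δ
        by-value false = +-cancelʳ-≡ X _ _ (begin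
          count (λ w → S w ∧ ⌊ D g δ w ≟ᴮ false ⌋) + X
            ≡⟨ cong (λ m → count (λ w → S w ∧ ⌊ D g δ w ≟ᴮ false ⌋) + m) (sym (count-differences S g δ)) ⟩
          count (λ w → S w ∧ ⌊ D g δ w ≟ᴮ false ⌋) + count (λ w → S w ∧ ⌊ D g δ w ≟ᴮ true ⌋)
            ≡⟨ count-by-value S (D g δ) ⟩
          N ≡⟨ sym (twice δ δ≢one) ⟩
          2 * X ≡⟨ cong (λ m → X + m) (+-identityʳ X) ⟩
          X + X ∎)
          where open ≡-Reasoning

  reps : Subgroup → Fin n → Bool
  reps H y = isRep y ∧ ofType H y

  count-reps : ∀ H → count (reps H) ≡ orbits H
  count-reps H = numOrbits≡orbits H (λ _ → refl)

  reps-ofType : ∀ {H y} → ofType H y ≡ false → reps H y ≡ false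
  reps-ofType {H} {y} e = trans (cong (isRep y ∧_) e) (∧-zeroʳ (isRep y))

  reps-nonrep : ∀ {H y} → isRep y ≡ false → reps H y ≡ false
  reps-nonrep {H} {y} e = cong (_∧ ofType H y) e

  ofType-unique : ∀ {H K y} → ofType H y ≡ true → (H == K) ≡ false → ofType K y ≡ false
  ofType-unique {y = y} e H≠K = trans (cong (_== _) (==-sound e)) H≠K

  repsOn-indicator : ∀ H (P : Fin n → Bool) → (∀ y → reps H y ≡ false → P y ≡ false) → repsOn H (𝕀 ∘ P) ≡ count P
  repsOn-indicator H P P⊆reps = trans (sum-cong-≗ pointwise) (sym (count≡∑ P))
    where
    x*[y*0]≡0 : ∀ x y → x * (y * 0) ≡ 0
    x*[y*0]≡0 = solve-∀
    pointwise : ∀ y → 𝕀 (ofType H y) * (𝕀 (isRep y) * 𝕀 (P y)) ≡ 𝕀 (P y)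
    pointwise y with isRep y in r | ofType H y in t | P y in Py
    ... | true | true | _ = trans (*-identityˡ _) (*-identityˡ _)
    ... | r′ | t′ | false = x*[y*0]≡0 (𝕀 t′) (𝕀 r′)
    ... | false | _ | true with () ← trans (sym Py) (P⊆reps y (cong (_∧ ofType H y) r))
    ... | true | false | true with () ← trans (sym Py) (P⊆reps y (reps-ofType t))

  repsOn-cong-reps : ∀ H {F G : Fin n → ℕ} → (∀ y → reps H y ≡ true → F y ≡ G y) → repsOn H F ≡ repsOn H G
  repsOn-cong-reps H {F} {G} F≡G = sumOn-cong (ofType H) pointwise
    where
    pointwise : ∀ y → ofType H y ≡ true → 𝕀 (isRep y) * F y ≡ 𝕀 (isRep y) * G y
    pointwise y t with isRep y in r
    ... | true = cong (1 *_) (F≡G y (cong₂ _∧_ r t))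
    ... | false = refl

  module _ (a cα cβ cγ p₁ q₁ r₁ : ℕ) (fits : a + cα + cβ + cγ ≤ orbits 𝟙)
           (p₁≤ : p₁ ≤ orbits ⟨α⟩) (q₁≤ : q₁ ≤ orbits ⟨β⟩) (r₁≤ : r₁ ≤ orbits ⟨γ⟩) where

    labels : List FreeOrbitType
    labels = replicate a odd ++ replicate cα splitα ++ replicate cβ splitβ ++ replicate cγ splitγ

    τ : Fin n → FreeOrbitType
    τ = deal constant labels (reps 𝟙)

    chosen : Subgroup → ℕ → Fin n → Bool
    chosen H k = deal false (replicate k true) (reps H)

    regularPart pairPart realisation : Fin n → Bool
    regularPart z = nonConstant (τ z) ∨ isSplitα (τ (α· z)) ∨ isSplitβ (τ (β· z)) ∨ isSplitγ (τ (γ· z))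
    pairPart z = chosen ⟨α⟩ p₁ z ∨ chosen ⟨β⟩ q₁ z ∨ chosen ⟨γ⟩ r₁ z
    realisation z = regularPart z ∨ pairPart z

    private
      τ-outside : ∀ z → reps 𝟙 z ≡ false → τ z ≡ constant
      τ-outside = deal-outside constant labels (reps 𝟙)

      chosen-outside : ∀ {H k z} → reps H z ≡ false → chosen H k z ≡ false
      chosen-outside {H} {k} {z} = deal-outside false (replicate k true) (reps H) z

      length-labels : length labels ≡ a + cα + cβ + cγ
      length-labels = begin
        length labels
          ≡⟨ length-++ (replicate a odd) ⟩
        length (replicate a odd) + length (replicate cα splitα ++ replicate cβ splitβ ++ replicate cγ splitγ)
          ≡⟨ cong (λ m → length (replicate a odd) + m) (trans (length-++ (replicate cα splitα)) (cong (λ m → length (replicate cα splitα) + m) (length-++ (replicate cβ splitβ)))) ⟩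
        length (replicate a odd) + (length (replicate cα splitα) + (length (replicate cβ splitβ) + length (replicate cγ splitγ)))
          ≡⟨ cong₄ (λ u v w x → u + (v + (w + x))) (length-replicate a) (length-replicate cα) (length-replicate cβ) (length-replicate cγ) ⟩
        a + (cα + (cβ + cγ))
          ≡⟨ reassociate a cα cβ cγ ⟩
        a + cα + cβ + cγ ∎
        where
        open ≡-Reasoning
        reassociate : ∀ a b c d → a + (b + (c + d)) ≡ a + b + c + d
        reassociate = solve-∀

      count-τ : ∀ f → f constant ≡ false →
        count (f ∘ τ) ≡ a * 𝕀 (f odd) + (cα * 𝕀 (f splitα) + (cβ * 𝕀 (f splitβ) + cγ * 𝕀 (f splitγ)))
      count-τ f f-constant = begin
        count (f ∘ τ)
          ≡⟨ count-deal f f-constant labels (reps 𝟙) (subst₂ _≤_ (sym length-labels) (sym (count-reps 𝟙)) fits) ⟩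
        occurrences f labels
          ≡⟨ occurrences-++ f (replicate a odd) _ ⟩
        occurrences f (replicate a odd) + occurrences f (replicate cα splitα ++ replicate cβ splitβ ++ replicate cγ splitγ)
          ≡⟨ cong (λ m → occurrences f (replicate a odd) + m)
               (trans (occurrences-++ f (replicate cα splitα) _) (cong (λ m → occurrences f (replicate cα splitα) + m) (occurrences-++ f (replicate cβ splitβ) _))) ⟩
        occurrences f (replicate a odd) + (occurrences f (replicate cα splitα) + (occurrences f (replicate cβ splitβ) + occurrences f (replicate cγ splitγ)))
          ≡⟨ cong₄ (λ u v w x → u + (v + (w + x))) (occurrences-replicate f a odd) (occurrences-replicate f cα splitα)
                   (occurrences-replicate f cβ splitβ) (occurrences-replicate f cγ splitγ) ⟩
        a * 𝕀 (f odd) + (cα * 𝕀 (f splitα) + (cβ * 𝕀 (f splitβ) + cγ * 𝕀 (f splitγ))) ∎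
        where open ≡-Reasoning

      count-chosen : ∀ H k → k ≤ orbits H → count (chosen H k) ≡ k
      count-chosen H k k≤ = begin
        count (chosen H k)                  ≡⟨ count-deal (λ b → b) refl (replicate k true) (reps H) (subst₂ _≤_ (sym (length-replicate k)) (sym (count-reps H)) k≤) ⟩
        occurrences (λ b → b) (replicate k true) ≡⟨ occurrences-replicate (λ b → b) k true ⟩
        k * 1                               ≡⟨ *-identityʳ k ⟩
        k                                   ∎
        where open ≡-Reasoning

      pairPart-off-pairs : ∀ {z} → ofType 𝟙 z ≡ true → pairPart z ≡ false
      pairPart-off-pairs e =
        cong₃ (λ u v w → u ∨ v ∨ w) (chosen-outside (reps-ofType (ofType-unique e refl)))
          (chosen-outside (reps-ofType (ofType-unique e refl))) (chosen-outside (reps-ofType (ofType-unique e refl)))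

      regularPart-off-regular : ∀ {z} → ofType 𝟙 z ≡ false → regularPart z ≡ false
      regularPart-off-regular {z} e =
        cong₄ (λ u v w x → nonConstant u ∨ isSplitα v ∨ isSplitβ w ∨ isSplitγ x)
          (τ-outside z (reps-ofType e)) (τ-outside (α· z) (reps-ofType (trans (ofType-α 𝟙 z) e)))
          (τ-outside (β· z) (reps-ofType (trans (ofType-β 𝟙 z) e))) (τ-outside (γ· z) (reps-ofType (trans (ofType-γ 𝟙 z) e)))

      on-regular : ∀ {z} → ofType 𝟙 z ≡ true → realisation z ≡ regularPart z
      on-regular {z} e = trans (cong (regularPart z ∨_) (pairPart-off-pairs e)) (∨-identityʳ _)

      off-regular : ∀ {z} → ofType 𝟙 z ≡ false → realisation z ≡ pairPart z
      off-regular {z} e = cong (_∨ pairPart z) (regularPart-off-regular e)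

    typeAt-realisation : ∀ {y} → reps 𝟙 y ≡ true → typeAt realisation y ≡ τ y
    typeAt-realisation {y} rep-y = begin
      typeAt realisation y
        ≡⟨ cong₃ freeOrbitType (cong₂ _xor_ at-α at-1) (cong₂ _xor_ at-β at-1) (cong₂ _xor_ at-γ at-1) ⟩
      freeOrbitType (isSplitα (τ y) xor nonConstant (τ y)) (isSplitβ (τ y) xor nonConstant (τ y)) (isSplitγ (τ y) xor nonConstant (τ y))
        ≡⟨ freeOrbitType-of-pattern (τ y) ⟩
      τ y ∎
      where
      open ≡-Reasoning
      rep : isRep y ≡ true
      rep = proj₁ (∧≡true {isRep y} rep-y)
      regular : ofType 𝟙 y ≡ true
      regular = proj₂ (∧≡true {isRep y} rep-y)
      others : isRep (α· y) ≡ false × isRep (β· y) ≡ false × isRep (γ· y) ≡ false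
      others = regular-rep-unique (==-sound regular) rep
      τα : τ (α· y) ≡ constant
      τα = τ-outside (α· y) (reps-nonrep (proj₁ others))
      τβ : τ (β· y) ≡ constant
      τβ = τ-outside (β· y) (reps-nonrep (proj₁ (proj₂ others)))
      τγ : τ (γ· y) ≡ constant
      τγ = τ-outside (γ· y) (reps-nonrep (proj₂ (proj₂ others)))
      value : ∀ {z} → ofType 𝟙 z ≡ ofType 𝟙 y → ∀ {u v w x} → τ z ≡ u → τ (α· z) ≡ v → τ (β· z) ≡ w → τ (γ· z) ≡ x →
        realisation z ≡ nonConstant u ∨ isSplitα v ∨ isSplitβ w ∨ isSplitγ x
      value {z} same ez eα eβ eγ =
        trans (on-regular (trans same regular)) (cong₄ (λ u v w x → nonConstant u ∨ isSplitα v ∨ isSplitβ w ∨ isSplitγ x) ez eα eβ eγ)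
      at-1 : realisation y ≡ nonConstant (τ y)
      at-1 = trans (value refl refl τα τβ τγ) (∨-identityʳ _)
      at-α : realisation (α· y) ≡ isSplitα (τ y)
      at-α = trans (value (ofType-α 𝟙 y) τα (cong τ (αα y)) (trans (cong τ (βα≡γ y)) τγ) (trans (cong τ (γα≡β y)) τβ))
                   (∨-identityʳ _)
      at-β : realisation (β· y) ≡ isSplitβ (τ y)
      at-β = trans (value (ofType-β 𝟙 y) τβ τγ (cong τ (ββ y)) (trans (cong τ (γβ≡α y)) τα)) (∨-identityʳ _)
      at-γ : realisation (γ· y) ≡ isSplitγ (τ y)
      at-γ = value (ofType-γ 𝟙 y) τγ (trans (cong τ (αγ≡β y)) τβ) (trans (cong τ (βγ≡α y)) τα) (cong τ (γγ y))

    private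
      difference-at-pair-rep : ∀ {y z} H k → ofType 𝟙 y ≡ false → ofType 𝟙 z ≡ false → isRep z ≡ false →
        pairPart y ≡ chosen H k y → realisation z xor realisation y ≡ chosen H k y
      difference-at-pair-rep {y} {z} H k y-off z-off z-nonrep pair-y
        rewrite off-regular y-off | off-regular z-off
              | chosen-outside {⟨α⟩} {p₁} {z} (reps-nonrep z-nonrep)
              | chosen-outside {⟨β⟩} {q₁} {z} (reps-nonrep z-nonrep)
              | chosen-outside {⟨γ⟩} {r₁} {z} (reps-nonrep z-nonrep) = pair-y

      pair-differences : ∀ H k (σ : Fin n → Fin n) → (H == 𝟙) ≡ false →
        (∀ {y} → stab y ≡ H → 𝕀 (isRep y) + 𝕀 (isRep (σ y)) ≡ 1) → (∀ y → ofType 𝟙 (σ y) ≡ ofType 𝟙 y) →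
        (∀ {y} → ofType H y ≡ true → pairPart y ≡ chosen H k y) →
        ∀ {y} → reps H y ≡ true → realisation (σ y) xor realisation y ≡ chosen H k y
      pair-differences H k σ H≠𝟙 one-rep σ-invariant pairPart≡ {y} rep-y =
        difference-at-pair-rep H k y-off (trans (σ-invariant y) y-off)
          (pair-rep-unique {y} {σ y} (one-rep (==-sound of-type)) (proj₁ (∧≡true {isRep y} rep-y))) (pairPart≡ of-type)
        where
        of-type : ofType H y ≡ true
        of-type = proj₂ (∧≡true {isRep y} rep-y)
        y-off : ofType 𝟙 y ≡ false
        y-off = ofType-unique of-type H≠𝟙

      pairPart-⟨α⟩ : ∀ {y} → ofType ⟨α⟩ y ≡ true → pairPart y ≡ chosen ⟨α⟩ p₁ y
      pairPart-⟨α⟩ {y} e = trans (cong₂ (λ u v → chosen ⟨α⟩ p₁ y ∨ u ∨ v)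
        (chosen-outside (reps-ofType (ofType-unique e refl))) (chosen-outside (reps-ofType (ofType-unique e refl)))) (∨-identityʳ _)

      pairPart-⟨β⟩ : ∀ {y} → ofType ⟨β⟩ y ≡ true → pairPart y ≡ chosen ⟨β⟩ q₁ y
      pairPart-⟨β⟩ {y} e = trans (cong₂ (λ u v → u ∨ chosen ⟨β⟩ q₁ y ∨ v)
        (chosen-outside (reps-ofType (ofType-unique e refl))) (chosen-outside (reps-ofType (ofType-unique e refl)))) (∨-identityʳ _)

      pairPart-⟨γ⟩ : ∀ {y} → ofType ⟨γ⟩ y ≡ true → pairPart y ≡ chosen ⟨γ⟩ r₁ y
      pairPart-⟨γ⟩ {y} e = cong₂ (λ u v → u ∨ v ∨ chosen ⟨γ⟩ r₁ y)
        (chosen-outside (reps-ofType (ofType-unique e refl))) (chosen-outside (reps-ofType (ofType-unique e refl)))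

      count-pairs : ∀ H k δ → (∀ {y} → reps H y ≡ true → D realisation δ y ≡ chosen H k y) →
        k ≤ orbits H → repsOn H (𝕀 ∘ D realisation δ) ≡ k
      count-pairs H k δ diff k≤ = begin
        repsOn H (𝕀 ∘ D realisation δ) ≡⟨ repsOn-cong-reps H (λ y r → cong 𝕀 (diff r)) ⟩
        repsOn H (𝕀 ∘ chosen H k)      ≡⟨ repsOn-indicator H (chosen H k) (λ y → chosen-outside) ⟩
        count (chosen H k)             ≡⟨ count-chosen H k k≤ ⟩
        k                              ∎
        where open ≡-Reasoning

      count-types : ∀ f → f constant ≡ false → repsOn 𝟙 (𝕀 ∘ f ∘ typeAt realisation) ≡ count (f ∘ τ)
      count-types f f-constant =
        trans (repsOn-cong-reps 𝟙 (λ y r → cong (𝕀 ∘ f) (typeAt-realisation r)))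
              (repsOn-indicator 𝟙 (f ∘ τ) (λ y nonrep → trans (cong f (τ-outside y nonrep)) f-constant))

      only : ∀ x y z w → (x * 1 + (y * 0 + (z * 0 + w * 0)) ≡ x) × (x * 0 + (y * 1 + (z * 0 + w * 0)) ≡ y) ×
                         (x * 0 + (y * 0 + (z * 1 + w * 0)) ≡ z) × (x * 0 + (y * 0 + (z * 0 + w * 1)) ≡ w)
      only x y z w = only₁ x y z w , only₂ x y z w , only₃ x y z w , only₄ x y z w
        where
        only₁ : ∀ x y z w → x * 1 + (y * 0 + (z * 0 + w * 0)) ≡ x
        only₁ = solve-∀
        only₂ : ∀ x y z w → x * 0 + (y * 1 + (z * 0 + w * 0)) ≡ y
        only₂ = solve-∀
        only₃ : ∀ x y z w → x * 0 + (y * 0 + (z * 1 + w * 0)) ≡ z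
        only₃ = solve-∀
        only₄ : ∀ x y z w → x * 0 + (y * 0 + (z * 0 + w * 1)) ≡ w
        only₄ = solve-∀

    profileOf-realisation : profileOf realisation ≡ profile a cα cβ cγ p₁ q₁ r₁
    profileOf-realisation = profile-≡
      (trans (count-types isOdd refl) (trans (count-τ isOdd refl) (proj₁ (only a cα cβ cγ))))
      (trans (count-types isSplitα refl) (trans (count-τ isSplitα refl) (proj₁ (proj₂ (only a cα cβ cγ)))))
      (trans (count-types isSplitβ refl) (trans (count-τ isSplitβ refl) (proj₁ (proj₂ (proj₂ (only a cα cβ cγ))))))
      (trans (count-types isSplitγ refl) (trans (count-τ isSplitγ refl) (proj₂ (proj₂ (proj₂ (only a cα cβ cγ))))))
      (count-pairs ⟨α⟩ p₁ β (pair-differences ⟨α⟩ p₁ β·_ refl one-rep-in-⟨α⟩-orbit (ofType-β 𝟙) pairPart-⟨α⟩) p₁≤)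
      (count-pairs ⟨β⟩ q₁ α (pair-differences ⟨β⟩ q₁ α·_ refl one-rep-in-⟨β⟩-orbit (ofType-α 𝟙) pairPart-⟨β⟩) q₁≤)
      (count-pairs ⟨γ⟩ r₁ α (pair-differences ⟨γ⟩ r₁ α·_ refl one-rep-in-⟨γ⟩-orbit (ofType-α 𝟙) pairPart-⟨γ⟩) r₁≤)

  HasGPN⇔balanced-profile :
    HasGPN A (everything A) ⇔ ∃ λ π → Admissible (orbits 𝟙) (orbits ⟨α⟩) (orbits ⟨β⟩) (orbits ⟨γ⟩) π × Balanced (4 * orbits 𝟙 + v₀) π
  HasGPN⇔balanced-profile = mk⇔ forward backward
    where
    open Equivalence
    N : ℕ
    N = count (everything A)
    differences : ∀ g δ → sumOn (everything A) (𝕀 ∘ D g δ) ≡ sum (𝕀 ∘ D g δ)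
    differences g δ = sumOn-true (𝕀 ∘ D g δ)
    four-times : ∀ {x} y → 2 * x ≡ N → x ≡ 2 * y → 4 * y ≡ 4 * orbits 𝟙 + v₀
    four-times {x} y twice x≡2y = trans (*-assoc 2 2 y) (trans (cong (2 *_) (sym x≡2y)) (trans twice count-everything))
    forward : HasGPN A (everything A) →
      ∃ λ π → Admissible (orbits 𝟙) (orbits ⟨α⟩) (orbits ⟨β⟩) (orbits ⟨γ⟩) π × Balanced (4 * orbits 𝟙 + v₀) π
    forward (g , perfect) = profileOf g , profileOf-admissible g ,
        four-times (Profile.Δα (profileOf g)) (twice α (λ ())) (trans (differences g α) (differences-α g))
      , four-times (Profile.Δβ (profileOf g)) (twice β (λ ())) (trans (differences g β) (differences-β g))
      , four-times (Profile.Δγ (profileOf g)) (twice γ (λ ())) (trans (differences g γ) (differences-γ g))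
      where
      twice : ∀ δ → δ ≢ one → 2 * sumOn (everything A) (𝕀 ∘ D g δ) ≡ N
      twice = to (IsGPN⇔ (everything A) g) perfect
    backward : (∃ λ π → Admissible (orbits 𝟙) (orbits ⟨α⟩) (orbits ⟨β⟩) (orbits ⟨γ⟩) π × Balanced (4 * orbits 𝟙 + v₀) π) →
      HasGPN A (everything A)
    backward (π@(profile a cα cβ cγ p₁ q₁ r₁) , (fits , p₁≤ , q₁≤ , r₁≤) , (bα , bβ , bγ)) =
      g , from (IsGPN⇔ (everything A) g) twice
      where
      g : Fin n → Bool
      g = realisation a cα cβ cγ p₁ q₁ r₁ fits p₁≤ q₁≤ r₁≤
      same-profile : profileOf g ≡ π
      same-profile = profileOf-realisation a cα cβ cγ p₁ q₁ r₁ fits p₁≤ q₁≤ r₁≤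
      balanced : ∀ {δ} (Δ : Profile → ℕ) → sum (𝕀 ∘ D g δ) ≡ 2 * Δ (profileOf g) → 4 * Δ π ≡ 4 * orbits 𝟙 + v₀ →
        2 * sumOn (everything A) (𝕀 ∘ D g δ) ≡ N
      balanced {δ} Δ diffs b = begin
        2 * sumOn (everything A) (𝕀 ∘ D g δ) ≡⟨ cong (2 *_) (trans (differences g δ) diffs) ⟩
        2 * (2 * Δ (profileOf g))            ≡⟨ cong (λ π′ → 2 * (2 * Δ π′)) same-profile ⟩
        2 * (2 * Δ π)                        ≡⟨ *-assoc 2 2 (Δ π) ⟨
        4 * Δ π                              ≡⟨ trans b (sym count-everything) ⟩
        N                                    ∎
        where open ≡-Reasoning
      twice : ∀ δ → δ ≢ one → 2 * sumOn (everything A) (𝕀 ∘ D g δ) ≡ N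
      twice one δ≢one = ⊥-elim (δ≢one refl)
      twice α _ = balanced {α} Profile.Δα (differences-α g) bα
      twice β _ = balanced {β} Profile.Δβ (differences-β g) bβ
      twice γ _ = balanced {γ} Profile.Δγ (differences-γ g) bγ

  HasGPN-nonFree⇒condition : HasGPN A (nonFree A) → Condition (orbits 𝟙) (orbits ⟨α⟩) (orbits ⟨β⟩) (orbits ⟨γ⟩) v₀
  HasGPN-nonFree⇒condition (g , perfect) =
    let (_ , p₁≤ , q₁≤ , r₁≤) = profileOf-admissible g
    in equal-pairs⇒condition _ _ _ _ _ p₁≤ q₁≤ r₁≤
         (halves α (q₁ + r₁) (λ ()) (nonFree-differences-α g))
         (halves β (p₁ + r₁) (λ ()) (nonFree-differences-β g))
         (halves γ (p₁ + q₁) (λ ()) (nonFree-differences-γ g))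
    where
    open Profile (profileOf g) using (p₁; q₁; r₁)
    twice : ∀ δ → δ ≢ one → 2 * sumOn (nonFree A) (𝕀 ∘ D g δ) ≡ count (nonFree A)
    twice = Equivalence.to (IsGPN⇔ (nonFree A) g) perfect
    halves : ∀ δ x → δ ≢ one → sumOn (nonFree A) (𝕀 ∘ D g δ) ≡ 2 * x → 2 * (2 * x) ≡ v₀
    halves δ x δ≢one e = trans (cong (2 *_) (sym e)) (trans (twice δ δ≢one) count-nonFree)

theorem5p8 : ∀ (n : ℕ) (A : KleinAction n) →
  let s = s# A
      p = p# A
      q = q# A
      r = r# A
      t = t# A
      v₀ = 2 * p + 2 * q + 2 * r + t
  in HasGPN A (everything A) ⇔
     (HasGPN A (nonFree A) ⊎
      ((4 ∣ v₀) ×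
       ∃ λ (k₀ : ℕ) → ∃ λ (p₁ : ℕ) → ∃ λ (q₁ : ℕ) → ∃ λ (r₁ : ℕ) →
         (p₁ ≤ p) × (q₁ ≤ q) × (r₁ ≤ r) ×
         (p₁ % 2 ≡ q₁ % 2) × (q₁ % 2 ≡ r₁ % 2) ×
         ((+ (3 * (v₀ / 4)) +ℤ + (4 * k₀)) - + (2 * (p₁ + q₁ + r₁)) ≤ℤ + s) ×
         (((2 * p₁ + (q₁ + r₁)) ⊔ (2 * q₁ + (p₁ + r₁))) ⊔ (2 * r₁ + (p₁ + q₁))
            ≤ 2 * (v₀ / 4 + k₀))))
theorem5p8 n A
  rewrite s#≡orbits A | p#≡orbits A | q#≡orbits A | r#≡orbits A | t#≡orbits A =
  mk⇔ (inj₂ ∘ to characterisation ∘ to (HasGPN⇔balanced-profile A))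
      (from (HasGPN⇔balanced-profile A) ∘ from characterisation ∘ [ HasGPN-nonFree⇒condition A , id ])
  where
  open Equivalence
  characterisation : (∃ λ π → Admissible (orbits A 𝟙) (orbits A ⟨α⟩) (orbits A ⟨β⟩) (orbits A ⟨γ⟩) π ×
                                Balanced (4 * orbits A 𝟙 + v₀ A) π) ⇔
                     Condition (orbits A 𝟙) (orbits A ⟨α⟩) (orbits A ⟨β⟩) (orbits A ⟨γ⟩) (v₀ A)
  characterisation = balanced⇔condition (orbits A 𝟙) (orbits A ⟨α⟩) (orbits A ⟨β⟩) (orbits A ⟨γ⟩) (v₀ A)
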